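{- Let $s > 0$ be an integer and let $0 < \varepsilon, \delta \le 1$ be real constants. For any bitstring $S$ of length $|S| = m$ containing exactly $n$ ones, there exists a fully indexable dictionary for $S$ that supports all the operations $\mathtt{rank}_0,\mathtt{rank}_1,\mathtt{select}_0,\mathtt{select}_1$ in time $O(s\delta^{ -1} + \varepsilon^{ -1})$ and uses $$B(n,m) + O\!\left(n^{1+\delta} + n\left(\frac{m}{n^s}\right)^{\varepsilon}\right)$$ bits of space.
   Context: The model of computation is the word RAM with word size $\Theta(\log m)$ bits; logarithms are base 2. For integers $0\le n\le m$, $B(n,m) = \lceil \log \binom{m}{n} \rceil$. For a bitstring $S$ of length $m$ and $b \in \{0,1\}$: $\mathtt{rank}_b(S,i)$ returns the number of occurrences of bit $b$ in the prefix $S[1..i]$; $\mathtt{select}_b(S,i)$ returns the position of the $i$th occurrence of bit $b$ in $S$. A fully indexable dictionary (FID) for $S$ is a static data structure storing $S$ (in any, possibly compressed, encoding) and supporting $\mathtt{rank}_b$ and $\mathtt{select}_b$ for both $b=0$ and $b=1$. The parameters $s,\delta,\varepsilon$ are fixed constants, independent of $n$ and $m$. -}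

module Defs where

open import Algebra.Definitions.RawSemiring as RawSemiring using ()
open import Data.Bool.Base using (Bool; true; false; _∧_; _∨_; _xor_; if_then_else_)
open import Data.Bool.Properties using (_≟_)
open import Data.Empty using (⊥)
open import Data.Fin.Base as Fin using ()
open import Data.Integer.Base as ℤ using ()
open import Data.List.Base using (List; []; _∷_; length; filter; take; drop; head)
open import Data.Maybe.Base using (Maybe; just; nothing; fromMaybe)
open import Data.Nat.Base
open import Data.Nat.Combinatorics using (_C_)
open import Data.Nat.DivMod using (_/_; _%_)
open import Data.Nat.Logarithm using (⌈log₂_⌉)
open import Data.Nat.Properties using (m^n≢0)
open import Data.Product using (_×_; _,_; ∃-syntax)
open import Data.Rational.Base as ℚ using (ℚ; 0ℚ; 1ℚ)
import Data.Rational.Properties as ℚ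
open import Data.Sum.Base using (_⊎_)
open import Data.Vec.Base using (Vec; []; _∷_; zipWith; tabulate)
open import Relation.Binary.PropositionalEquality using (_≡_; sym; trans; cong; subst)
open import Relation.Nullary using (¬_; yes; no)

------------------------------------------------------------------------
-- Bitstrings (positions are 1-based)

occ : Bool → List Bool → ℕ
occ b S = length (filter (b ≟_) S)

rank : Bool → List Bool → ℕ → ℕ
rank b S i = occ b (take i S)

-- Meaningful for 1 ≤ i ≤ occ b S; `select b S 0` is 0, which makes the
-- last clause right for the first occurrence as well.
select : Bool → List Bool → ℕ → ℕ
select b S       zero    = 0
select b []      (suc i) = 0
select b (x ∷ S) (suc i) with b ≟ x
... | yes _ = suc (select b S i)
... | no  _ = suc (select b S (suc i))

B : ℕ → ℕ → ℕ
B n m = ⌈log₂ (m C n) ⌉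

-- The number of bits needed to write every integer in 0 … m; unlike
-- log m it is nonzero for m = 1, and it is Θ(log m) for m ≥ 2.
lg : ℕ → ℕ
lg m = ⌈log₂ (suc m) ⌉

------------------------------------------------------------------------
-- The word RAM

-- Least significant bit first.
Word : ℕ → Set
Word w = Vec Bool w

toℕ : ∀ {w} → Word w → ℕ
toℕ []      = 0
toℕ (b ∷ v) = (if b then 1 else 0) + 2 * toℕ v

-- Reduces modulo 2 ^ w.
fromℕ : ∀ w → ℕ → Word w
fromℕ zero    k = []
fromℕ (suc w) k = (k % 2 ≡ᵇ 1) ∷ fromℕ w (k / 2)

data BinOp : Set where
  add sub mul div mod and or xor shl shr : BinOp

-- Arithmetic is modulo 2 ^ w; division by zero gives 0.
⟦_⟧ : BinOp → ∀ {w} → Word w → Word w → Word w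
⟦ add ⟧ {w} u v = fromℕ w (toℕ u + toℕ v)
⟦ sub ⟧ {w} u v = fromℕ w (toℕ u + (2 ^ w ∸ toℕ v))
⟦ mul ⟧ {w} u v = fromℕ w (toℕ u * toℕ v)
⟦ div ⟧ {w} u v with toℕ v
... | zero      = fromℕ w 0
... | k@(suc _) = fromℕ w (toℕ u / k)
⟦ mod ⟧ {w} u v with toℕ v
... | zero      = fromℕ w 0
... | k@(suc _) = fromℕ w (toℕ u % k)
⟦ and ⟧     u v = zipWith _∧_ u v
⟦ or  ⟧     u v = zipWith _∨_ u v
⟦ xor ⟧     u v = zipWith _xor_ u v
⟦ shl ⟧ {w} u v = fromℕ w (toℕ u * 2 ^ toℕ v)
⟦ shr ⟧ {w} u v = fromℕ w ((toℕ u / 2 ^ toℕ v) {{m^n≢0 2 (toℕ v)}})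

Reg : Set
Reg = ℕ

data Instr : Set where
  const   : Reg → ℕ → Instr                  -- r ← k
  move    : Reg → Reg → Instr                -- r ← a
  bin     : BinOp → Reg → Reg → Reg → Instr  -- r ← a ∘ b
  load    : Reg → Reg → Instr                -- r ← M[a]
  store   : Reg → Reg → Instr                -- M[a] ← b
  jump    : ℕ → Instr
  jump-eq : Reg → Reg → ℕ → Instr            -- jump if a = b
  jump-lt : Reg → Reg → ℕ → Instr            -- jump if a < b

-- A program mentions only finitely many registers.
Program : Set
Program = List Instr

-- An address is a word, so only the cells below 2 ^ w can be accessed.
record State (w : ℕ) : Set where
  constructor state
  field
    pc  : ℕ
    reg : Reg → Word w
    mem : ℕ → Word w

open State public

_[_↦_] : {A : Set} → (ℕ → A) → ℕ → A → (ℕ → A)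
(f [ i ↦ x ]) k = if k ≡ᵇ i then x else f k

exec : ∀ {w} → Instr → State w → State w
exec {w} (const r k) (state p R M) = state (suc p) (R [ r ↦ fromℕ w k ]) M
exec (move r a)      (state p R M) = state (suc p) (R [ r ↦ R a ]) M
exec (bin o r a b)   (state p R M) = state (suc p) (R [ r ↦ ⟦ o ⟧ (R a) (R b) ]) M
exec (load r a)      (state p R M) = state (suc p) (R [ r ↦ M (toℕ (R a)) ]) M
exec (store a b)     (state p R M) = state (suc p) R (M [ toℕ (R a) ↦ R b ])
exec (jump l)        (state p R M) = state l R M
exec (jump-eq a b l) (state p R M) =
  state (if toℕ (R a) ≡ᵇ toℕ (R b) then l else suc p) R M
exec (jump-lt a b l) (state p R M) =
  state (if toℕ (R a) <ᵇ toℕ (R b) then l else suc p) R M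

nth : {A : Set} → List A → ℕ → Maybe A
nth xs k = head (drop k xs)

-- P ⊢ σ ⇓⟨ t ⟩ τ: started in σ, the program P halts in τ after exactly t
-- instructions. It halts when the program counter leaves the program.
data _⊢_⇓⟨_⟩_ {w : ℕ} (P : Program) : State w → ℕ → State w → Set where
  halt : ∀ {σ} → nth P (pc σ) ≡ nothing → P ⊢ σ ⇓⟨ 0 ⟩ σ
  step : ∀ {I σ t τ} → nth P (pc σ) ≡ just I →
         P ⊢ exec I σ ⇓⟨ t ⟩ τ → P ⊢ σ ⇓⟨ suc t ⟩ τ

-- The bits of D packed into consecutive w-bit cells, followed by zeros.
image : ∀ w → List Bool → ℕ → Word w
image w D a = tabulate λ j → fromMaybe false (nth D (a * w + Fin.toℕ j))

-- The argument is passed in register 0; all other registers start at 0.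
start : ∀ w → List Bool → ℕ → State w
start w D i = state 0 ((λ _ → fromℕ w 0) [ 0 ↦ fromℕ w i ]) (image w D)

------------------------------------------------------------------------
-- Real numbers

-- Two-sided Dedekind cuts: `lower q` is q < x and `upper q` is x < q.
record ℝ : Set₁ where
  field
    lower upper     : ℚ → Set
    lower-inhabited : ∃[ q ] lower q
    upper-inhabited : ∃[ q ] upper q
    lower-closed    : ∀ {p q} → p ℚ.< q → lower q → lower p
    upper-closed    : ∀ {p q} → p ℚ.< q → upper p → upper q
    lower-open      : ∀ {p} → lower p → ∃[ q ] (p ℚ.< q × lower q)
    upper-open      : ∀ {q} → upper q → ∃[ p ] (p ℚ.< q × upper p)
    disjoint        : ∀ {q} → lower q → upper q → ⊥
    located         : ∀ {p q} → p ℚ.< q → lower p ⊎ upper q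

open ℝ public

_<ᴿ_ : ℚ → ℝ → Set
q <ᴿ x = lower x q

_≤ᴿ_ : ℝ → ℚ → Set
x ≤ᴿ q = ¬ (q <ᴿ x)

private
  add-sub : ∀ q r → (q ℚ.+ r) ℚ.- r ≡ q
  add-sub q r = trans (ℚ.+-assoc q r (ℚ.- r))
    (trans (cong (q ℚ.+_) (ℚ.+-inverseʳ r)) (ℚ.+-identityʳ q))

  sub-add : ∀ q r → (q ℚ.- r) ℚ.+ r ≡ q
  sub-add q r = trans (ℚ.+-assoc q (ℚ.- r) r)
    (trans (cong (q ℚ.+_) (ℚ.+-inverseˡ r)) (ℚ.+-identityʳ q))

  sub-< : ∀ {p q} r → p ℚ.< q → p ℚ.- r ℚ.< q ℚ.- r
  sub-< r = ℚ.+-monoˡ-< (ℚ.- r)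

_+ᴿ_ : ℚ → ℝ → ℝ
r +ᴿ x = record
  { lower           = λ q → lower x (q ℚ.- r)
  ; upper           = λ q → upper x (q ℚ.- r)
  ; lower-inhabited = let q , l = lower-inhabited x in
                      q ℚ.+ r , subst (lower x) (sym (add-sub q r)) l
  ; upper-inhabited = let q , u = upper-inhabited x in
                      q ℚ.+ r , subst (upper x) (sym (add-sub q r)) u
  ; lower-closed    = λ p<q → lower-closed x (sub-< r p<q)
  ; upper-closed    = λ p<q → upper-closed x (sub-< r p<q)
  ; lower-open      = λ {p} l → let q , p<q , l′ = lower-open x l in
                      q ℚ.+ r
                      , subst (ℚ._< q ℚ.+ r) (sub-add p r) (ℚ.+-monoˡ-< r p<q)
                      , subst (lower x) (sym (add-sub q r)) l′
  ; upper-open      = λ {q} u → let p , p<q , u′ = upper-open x u in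
                      p ℚ.+ r
                      , subst (p ℚ.+ r ℚ.<_) (sub-add q r) (ℚ.+-monoˡ-< r p<q)
                      , subst (upper x) (sym (add-sub p r)) u′
  ; disjoint        = disjoint x
  ; located         = λ p<q → located x (sub-< r p<q)
  }

------------------------------------------------------------------------
-- Nonnegative real quantities occurring as upper bounds

-- A real x ≥ 0 is determined by the rationals q with x < q. Only
-- comparisons of the form k ≤ x are needed, so expressions built from real
-- parameters are represented by this upper cut alone.
ℝ⁺ : Set₁
ℝ⁺ = ℚ → Set

ℕ→ℚ : ℕ → ℚ
ℕ→ℚ k = ℤ.+ k ℚ./ 1

infix  4 _≤⁺_
infixl 6 _⊕_
infixl 7 _⊗_
infix  8 ⌜_⌝

⌜_⌝ : ℕ → ℝ⁺
⌜ k ⌝ q = ℕ→ℚ k ℚ.< q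

_⊕_ : ℝ⁺ → ℝ⁺ → ℝ⁺
(x ⊕ y) q = ∃[ a ] ∃[ b ] (x a × y b × a ℚ.+ b ℚ.≤ q)

_⊗_ : ℝ⁺ → ℝ⁺ → ℝ⁺
(x ⊗ y) q = ∃[ a ] ∃[ b ] (x a × y b × a ℚ.* b ℚ.≤ q)

-- For x > 0: 1/x < q iff 1/p ≤ q for some rational 0 < p < x.
recip : ℝ → ℝ⁺
recip x q = ∃[ p ] (0ℚ ℚ.< p × p <ᴿ x × 1ℚ ℚ.≤ p ℚ.* q)

open RawSemiring ℚ.+-*-rawSemiring public using () renaming (_^_ to _^ℚ_)

-- For rational x > 0 and real e > 0: since r ↦ x ^ r is continuous and
-- monotone (increasing if x ≥ 1, decreasing if x ≤ 1), x ^ e < q holds iff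
-- x ^ (a/b) < q and x ^ (c/d) < q for some a/b < e < c/d. For q > 0 these
-- amount to x ^ a < q ^ b and x ^ c < q ^ d.
pow : ℚ → ℝ → ℝ⁺
pow x e q = 0ℚ ℚ.< q ×
  ∃[ a ] ∃[ b ] ∃[ c ] ∃[ d ]
    ( lower e (ℤ.+ a ℚ./ suc b) × x ^ℚ a ℚ.< q ^ℚ suc b
    × upper e (ℤ.+ c ℚ./ suc d) × x ^ℚ c ℚ.< q ^ℚ suc d )

_≤⁺_ : ℕ → ℝ⁺ → Set
k ≤⁺ x = ∀ q → x q → ℕ→ℚ k ℚ.≤ q

------------------------------------------------------------------------
-- Fully indexable dictionaries

data Op : Set where
  rank-op select-op : Bool → Op

Valid : Op → List Bool → ℕ → Set
Valid (rank-op b)   S i = i ≤ length S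
Valid (select-op b) S i = 1 ≤ i × i ≤ occ b S

answer : Op → List Bool → ℕ → ℕ
answer (rank-op b)   = rank b
answer (select-op b) = select b

-- On words of w bits, the stored bits D together with the query programs Q
-- are an FID for S with query time at most T. The structure being static,
-- a query has to leave the memory as it found it.
IsFID : ℕ → (Op → Program) → List Bool → List Bool → ℝ⁺ → Set
IsFID w Q S D T = ∀ op i → Valid op S i →
  ∃[ t ] ∃[ τ ]
    ( Q op ⊢ start w D i ⇓⟨ t ⟩ τ
    × toℕ (reg τ 0) ≡ answer op S i
    × (∀ a → mem τ a ≡ image w D a)
    × t ≤⁺ T )

-- For constant s, δ and ε, the redundancy n^(1+δ) + n (m/n^s)^ε is at least a
-- constant times n f^2, where f = m^(1/K) with K about 2 (s/δ + 1/ε): if X is the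
-- maximum of n^δ and (m/n^s)^ε, then m = n^s (m/n^s) ≤ X^(K/2). As log m = O(f),
-- it pays for O(n f) cells of O(log m) bits, and nothing needs to be compressed.
-- Both rank_1 and the number of ones before the i-th zero are monotone functions
-- of i with values in 0 … n. Each is tabulated as an f-ary trie of depth at most K
-- that branches only where the function is not constant, so that n f cells per
-- level suffice; the answers to select_1 are tabulated directly.
{-# OPTIONS --safe #-}
module Submission where

open import Defs

-- The reals `δ` and `ε` are replaced by integers `suc k₁` and `suc k₂`. Each has its reciprocal
-- below the real, so that it can stand in for the exponent in the space bound, and is at most three
-- times the reciprocal of the real, so that the depth stays within the time bound. The integers are
-- exact for neither purpose because a real can be compared with a rational only up to a gap. No
-- real root or fractional power is ever formed: inequalities with rational exponents are raised to
-- integer powers and cancelled there. The tables need rounding to integers as well: the arity is a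
-- power of two slightly above m^(1/K), and all that this costs is a constant factor of the
-- redundancy.

module Reals where

  open import Algebra.Bundles using (CommutativeRing)
  open import Data.Integer.Base as ℤ using (+_)
  import Data.Integer.Properties as ℤ
  open import Data.Nat.Base as ℕ using (ℕ; zero; suc; NonZero)
  import Data.Nat.Properties as ℕ
  import Data.Nat.Tactic.RingSolver as ℕ-Solver
  open import Data.Product using (_×_; _,_; ∃-syntax; proj₁; proj₂)
  open import Data.Rational.Base as ℚ using (ℚ; 0ℚ; 1ℚ; mkℚ)
  import Data.Rational.Properties as ℚ
  open import Data.Rational.Unnormalised.Base as ℚᵘ using (mkℚᵘ; *≡*; *≤*; *<*)
  import Data.Rational.Unnormalised.Properties as ℚᵘ
  open import Data.Sum.Base using (inj₁; inj₂; [_,_]′)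
  open import Relation.Binary.Definitions using (tri<; tri≈; tri>)
  open import Relation.Binary.PropositionalEquality
  open import Relation.Nullary using (yes; no; contradiction)
  import Algebra.Properties.CommutativeSemiring.Exp
    (CommutativeRing.commutativeSemiring ℚ.+-*-commutativeRing) as Exp

  -- Rational arithmetic and integer powers

  toℚᵘ-/ : ∀ i n → ℚ.toℚᵘ (i ℚ./ suc n) ℚᵘ.≃ mkℚᵘ i n
  toℚᵘ-/ i n = ℚ.toℚᵘ-fromℚᵘ (mkℚᵘ i n)

  -- `ℚ` normalises its results by gcds. On unnormalised representatives the claim is an integer
  -- identity between cross products; the next lemmas on `_/_` proceed in the same way.
  ℕ→ℚ-+ : ∀ a b → ℕ→ℚ (a ℕ.+ b) ≡ ℕ→ℚ a ℚ.+ ℕ→ℚ b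
  ℕ→ℚ-+ a b = ℚ.toℚᵘ-injective (ℚᵘ.≃-trans (toℚᵘ-/ (+ (a ℕ.+ b)) 0) (ℚᵘ.≃-sym
    (ℚᵘ.≃-trans (ℚ.toℚᵘ-homo-+ (ℕ→ℚ a) (ℕ→ℚ b)) (ℚᵘ.≃-trans (ℚᵘ.+-cong (toℚᵘ-/ (+ a) 0) (toℚᵘ-/ (+ b) 0))
    (*≡* (cong (ℤ._* + 1) (cong₂ ℤ._+_ (ℤ.*-identityʳ (+ a)) (ℤ.*-identityʳ (+ b)))))))))

  ℕ→ℚ-* : ∀ a b → ℕ→ℚ (a ℕ.* b) ≡ ℕ→ℚ a ℚ.* ℕ→ℚ b
  ℕ→ℚ-* a b = ℚ.toℚᵘ-injective (ℚᵘ.≃-trans (toℚᵘ-/ (+ (a ℕ.* b)) 0) (ℚᵘ.≃-sym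
    (ℚᵘ.≃-trans (ℚ.toℚᵘ-homo-* (ℕ→ℚ a) (ℕ→ℚ b)) (ℚᵘ.≃-trans (ℚᵘ.*-cong (toℚᵘ-/ (+ a) 0) (toℚᵘ-/ (+ b) 0))
    (*≡* (cong (ℤ._* + 1) (sym (ℤ.pos-* a b))))))))

  ℕ→ℚ-^ : ∀ a k → ℕ→ℚ (a ℕ.^ k) ≡ ℕ→ℚ a ^ℚ k
  ℕ→ℚ-^ a zero    = refl
  ℕ→ℚ-^ a (suc k) = trans (ℕ→ℚ-* a (a ℕ.^ k)) (cong (ℕ→ℚ a ℚ.*_) (ℕ→ℚ-^ a k))

  ℕ→ℚ-mono-≤ : ∀ {a b} → a ℕ.≤ b → ℕ→ℚ a ℚ.≤ ℕ→ℚ b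
  ℕ→ℚ-mono-≤ {a} {b} a≤b = ℚ.toℚᵘ-cancel-≤ (ℚᵘ.≤-respˡ-≃ (ℚᵘ.≃-sym (toℚᵘ-/ (+ a) 0))
    (ℚᵘ.≤-respʳ-≃ (ℚᵘ.≃-sym (toℚᵘ-/ (+ b) 0)) (*≤* (ℤ.*-monoʳ-≤-nonNeg (+ 1) (ℤ.+≤+ a≤b)))))

  /-cancel-< : ∀ {a b c d} → + a ℚ./ suc b ℚ.< + c ℚ./ suc d → a ℕ.* suc d ℕ.< c ℕ.* suc b
  /-cancel-< {a} {b} {c} {d} p with ℚᵘ.<-respˡ-≃ (toℚᵘ-/ (+ a) b) (ℚᵘ.<-respʳ-≃ (toℚᵘ-/ (+ c) d) (ℚ.toℚᵘ-mono-< p))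
  ... | *<* q = ℤ.drop‿+<+ (subst₂ ℤ._<_ (sym (ℤ.pos-* a (suc d))) (sym (ℤ.pos-* c (suc b))) q)

  /-mono-< : ∀ {a b c d} → a ℕ.* suc d ℕ.< c ℕ.* suc b → + a ℚ./ suc b ℚ.< + c ℚ./ suc d
  /-mono-< {a} {b} {c} {d} p = ℚ.toℚᵘ-cancel-< (ℚᵘ.<-respˡ-≃ (ℚᵘ.≃-sym (toℚᵘ-/ (+ a) b))
    (ℚᵘ.<-respʳ-≃ (ℚᵘ.≃-sym (toℚᵘ-/ (+ c) d)) (*<* (subst₂ ℤ._<_ (ℤ.pos-* a (suc d)) (ℤ.pos-* c (suc b)) (ℤ.+<+ p)))))

  /-*-cancel : ∀ a d .{{_ : NonZero d}} → ℕ→ℚ d ℚ.* (+ a ℚ./ d) ≡ ℕ→ℚ a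
  /-*-cancel a d@(suc d′) = ℚ.toℚᵘ-injective (ℚᵘ.≃-trans (ℚ.toℚᵘ-homo-* (ℕ→ℚ d) (+ a ℚ./ d))
    (ℚᵘ.≃-trans (ℚᵘ.*-cong (toℚᵘ-/ (+ d) 0) (toℚᵘ-/ (+ a) d′)) (ℚᵘ.≃-trans
    (*≡* (trans (ℤ.*-identityʳ _) (trans (ℤ.*-comm (+ d) (+ a)) (cong (λ k → + a ℤ.* + k) (sym (ℕ.*-identityˡ d)))))) (ℚᵘ.≃-sym (toℚᵘ-/ (+ a) 0)))))

  *-mono-≤ : ∀ {p q r s} → 0ℚ ℚ.≤ p → 0ℚ ℚ.≤ r → p ℚ.≤ q → r ℚ.≤ s → p ℚ.* r ℚ.≤ q ℚ.* s
  *-mono-≤ {p} {q} {r} {s} 0≤p 0≤r p≤q r≤s = ℚ.≤-trans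
    (ℚ.*-monoʳ-≤-nonNeg r {{ℚ.nonNegative 0≤r}} p≤q)
    (ℚ.*-monoˡ-≤-nonNeg q {{ℚ.nonNegative (ℚ.≤-trans 0≤p p≤q)}} r≤s)

  *-nonNeg : ∀ {p q} → 0ℚ ℚ.≤ p → 0ℚ ℚ.≤ q → 0ℚ ℚ.≤ p ℚ.* q
  *-nonNeg {p} {q} 0≤p 0≤q = subst (ℚ._≤ p ℚ.* q) (ℚ.*-zeroˡ 0ℚ) (*-mono-≤ ℚ.≤-refl ℚ.≤-refl 0≤p 0≤q)

  *-pos : ∀ {p q} → 0ℚ ℚ.< p → 0ℚ ℚ.< q → 0ℚ ℚ.< p ℚ.* q
  *-pos {p} {q} 0<p 0<q = subst (ℚ._< p ℚ.* q) (ℚ.*-zeroʳ p) (ℚ.*-monoʳ-<-pos p {{ℚ.positive 0<p}} 0<q)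

  0≤ℕ→ℚ : ∀ k → 0ℚ ℚ.≤ ℕ→ℚ k
  0≤ℕ→ℚ k = ℕ→ℚ-mono-≤ {0} {k} ℕ.z≤n

  ^-nonNeg : ∀ {x} → 0ℚ ℚ.≤ x → ∀ k → 0ℚ ℚ.≤ x ^ℚ k
  ^-nonNeg 0≤x zero    = 0≤ℕ→ℚ 1
  ^-nonNeg 0≤x (suc k) = *-nonNeg 0≤x (^-nonNeg 0≤x k)

  ^-pos : ∀ {x} → 0ℚ ℚ.< x → ∀ k → 0ℚ ℚ.< x ^ℚ k
  ^-pos 0<x zero    = ℚ.*<* (ℤ.+<+ (ℕ.s≤s ℕ.z≤n))
  ^-pos 0<x (suc k) = *-pos 0<x (^-pos 0<x k)

  ^-monoˡ-≤ : ∀ {x y} → 0ℚ ℚ.≤ x → x ℚ.≤ y → ∀ k → x ^ℚ k ℚ.≤ y ^ℚ k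
  ^-monoˡ-≤ 0≤x x≤y zero    = ℚ.≤-refl
  ^-monoˡ-≤ 0≤x x≤y (suc k) = *-mono-≤ 0≤x (^-nonNeg 0≤x k) x≤y (^-monoˡ-≤ 0≤x x≤y k)

  1≤^ : ∀ {x} → 1ℚ ℚ.≤ x → ∀ k → 1ℚ ℚ.≤ x ^ℚ k
  1≤^ 1≤x zero    = ℚ.≤-refl
  1≤^ 1≤x (suc k) = *-mono-≤ (0≤ℕ→ℚ 1) (0≤ℕ→ℚ 1) 1≤x (1≤^ 1≤x k)

  ^-monoʳ-≤ : ∀ {x} → 1ℚ ℚ.≤ x → ∀ {j k} → j ℕ.≤ k → x ^ℚ j ℚ.≤ x ^ℚ k
  ^-monoʳ-≤ 1≤x {k = k} ℕ.z≤n  = 1≤^ 1≤x k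
  ^-monoʳ-≤ 1≤x (ℕ.s≤s {j} j≤k) = *-mono-≤ 0≤x (^-nonNeg 0≤x j) ℚ.≤-refl (^-monoʳ-≤ 1≤x j≤k)
    where 0≤x = ℚ.≤-trans (0≤ℕ→ℚ 1) 1≤x

  -- Powers with real exponents and the redundancy

  lower<upper : ∀ (x : ℝ) {p q} → lower x p → upper x q → p ℚ.< q
  lower<upper x {p} {q} l u with ℚ.<-cmp p q
  ... | tri< p<q _    _   = p<q
  ... | tri≈ _   refl _   = contradiction u (disjoint x l)
  ... | tri> _   _    q<p = contradiction u (disjoint x (lower-closed x q<p l))

  ^-monoˡ-< : ∀ {x y} → 0ℚ ℚ.≤ x → x ℚ.< y → ∀ k → x ^ℚ suc k ℚ.< y ^ℚ suc k
  ^-monoˡ-< {x} {y} 0≤x x<y k = ℚ.≤-<-trans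
    (ℚ.*-monoˡ-≤-nonNeg x {{ℚ.nonNegative 0≤x}} (^-monoˡ-≤ 0≤x (ℚ.<⇒≤ x<y) k))
    (ℚ.*-monoˡ-<-pos (y ^ℚ k) {{ℚ.positive (^-pos (ℚ.≤-<-trans 0≤x x<y) k)}} x<y)

  -- The substitute for taking roots: a strict inequality the other way round would survive the
  -- power.
  ^-cancelˡ-≤ : ∀ {x y} → 0ℚ ℚ.≤ y → ∀ k → x ^ℚ suc k ℚ.≤ y ^ℚ suc k → x ℚ.≤ y
  ^-cancelˡ-≤ {x} {y} 0≤y k p with x ℚ.≤? y
  ... | yes x≤y = x≤y
  ... | no  x≰y = contradiction (ℚ.<-≤-trans (^-monoˡ-< 0≤y (ℚ.≰⇒> x≰y) k) p) (ℚ.<-irrefl refl)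

  ^-exchange : ∀ (x : ℚ) j k → (x ^ℚ j) ^ℚ k ≡ (x ^ℚ k) ^ℚ j
  ^-exchange x j k = trans (Exp.^-assocʳ x j k) (trans (cong (x ^ℚ_) (ℕ.*-comm j k)) (sym (Exp.^-assocʳ x k j)))

  1+1/k : ∀ k → + suc (suc k) ℚ./ suc k ≡ 1ℚ ℚ.+ + 1 ℚ./ suc k
  1+1/k k = ℚ.toℚᵘ-injective (ℚᵘ.≃-trans (toℚᵘ-/ (+ suc (suc k)) k) (ℚᵘ.≃-sym
    (ℚᵘ.≃-trans (ℚ.toℚᵘ-homo-+ 1ℚ (+ 1 ℚ./ suc k)) (ℚᵘ.≃-trans (ℚᵘ.+-congʳ (ℚ.toℚᵘ 1ℚ) (toℚᵘ-/ (+ 1) k))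
    (*≡* (cong +_ (cong₂ ℕ._*_ numerator (sym denominator))))))))
    where
    denominator : suc (k ℕ.+ 0) ≡ suc k
    denominator = cong suc (ℕ.+-identityʳ k)
    numerator : suc (k ℕ.+ 0 ℕ.+ 1) ≡ suc (suc k)
    numerator = cong suc (trans (cong (ℕ._+ 1) (ℕ.+-identityʳ k)) (ℕ.+-comm k 1))

  -- For `x` at least 1, the upper approximation `c / suc d` of the exponent exceeds `1 / suc k`, so
  -- that q > x^(c / suc d) ≥ x^(1 / suc k). Both sides are compared after raising them to the power
  -- `suc d`.
  pow-exponent : ∀ {x e q k} → 1ℚ ℚ.≤ x → lower e (+ 1 ℚ./ suc k) → pow x e q → x ℚ.≤ q ^ℚ suc k
  pow-exponent {x} {e} {q} {k} 1≤x l (0<q , _ , _ , c , d , _ , _ , u , x^c<q^d) =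
    ^-cancelˡ-≤ (^-nonNeg (ℚ.<⇒≤ 0<q) (suc k)) d (begin
      x ^ℚ suc d            ≤⟨ ^-monoʳ-≤ 1≤x (ℕ.≤-trans (ℕ.≤-reflexive (sym (ℕ.*-identityˡ (suc d))))
                                (ℕ.<⇒≤ (/-cancel-< {1} {k} {c} {d} (lower<upper e l u)))) ⟩
      x ^ℚ (c ℕ.* suc k)     ≡⟨ Exp.^-assocʳ x c (suc k) ⟨
      (x ^ℚ c) ^ℚ suc k      ≤⟨ ^-monoˡ-≤ (^-nonNeg 0≤x c) (ℚ.<⇒≤ x^c<q^d) (suc k) ⟩
      (q ^ℚ suc d) ^ℚ suc k  ≡⟨ ^-exchange q (suc d) (suc k) ⟩
      (q ^ℚ suc k) ^ℚ suc d  ∎)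
    where
    open ℚ.≤-Reasoning
    0≤x = ℚ.≤-trans (0≤ℕ→ℚ 1) 1≤x

  -- Here `q` is at least x^(1 + 1 / suc k), and `g` is an upper bound of q / x, so `g` is at least
  -- x^(1 / suc k). The division by `x` becomes the cancellation of its power `y` in `bound`.
  pow-1+-exponent : ∀ {x δ q k} → 1ℚ ℚ.≤ x → lower δ (+ 1 ℚ./ suc k) →
    pow x (1ℚ +ᴿ δ) q → x ℚ.≤ q × (∀ {g} → 0ℚ ℚ.≤ g → q ℚ.≤ x ℚ.* g → x ℚ.≤ g ^ℚ suc k)
  pow-1+-exponent {x} {δ} {q} {k} 1≤x l (0<q , _ , _ , c , d , _ , _ , u , x^c<q^d) = x≤q , bound
    where
    open ℚ.≤-Reasoning
    0≤x = ℚ.≤-trans (0≤ℕ→ℚ 1) 1≤x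
    0<x = ℚ.<-≤-trans {0ℚ} {1ℚ} (ℚ.*<* (ℤ.+<+ (ℕ.s≤s ℕ.z≤n))) 1≤x
    [1+k]d<ck : suc (suc k) ℕ.* suc d ℕ.< c ℕ.* suc k
    [1+k]d<ck = /-cancel-< {suc (suc k)} {k} {c} {d} (lower<upper (1ℚ +ᴿ δ)
      (subst (lower δ) (sym (trans (cong (ℚ._- 1ℚ) (trans (1+1/k k) (ℚ.+-comm 1ℚ r)))
        (trans (ℚ.+-assoc r 1ℚ (ℚ.- 1ℚ)) (trans (cong (r ℚ.+_) (ℚ.+-inverseʳ 1ℚ)) (ℚ.+-identityʳ r))))) l) u)
      where r = + 1 ℚ./ suc k
    d≤c : suc d ℕ.≤ c
    d≤c = ℕ.*-cancelʳ-≤ (suc d) c (suc k) (ℕ.≤-trans (ℕ.≤-reflexive (ℕ.*-comm (suc d) (suc k)))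
      (ℕ.≤-trans (ℕ.m≤n+m (suc k ℕ.* suc d) (suc d)) (ℕ.<⇒≤ [1+k]d<ck)))
    x≤q : x ℚ.≤ q
    x≤q = ^-cancelˡ-≤ (ℚ.<⇒≤ 0<q) d (ℚ.≤-trans (^-monoʳ-≤ 1≤x d≤c) (ℚ.<⇒≤ x^c<q^d))
    bound : ∀ {g} → 0ℚ ℚ.≤ g → q ℚ.≤ x ℚ.* g → x ℚ.≤ g ^ℚ suc k
    bound {g} 0≤g q≤xg = ^-cancelˡ-≤ (^-nonNeg 0≤g (suc k)) d
      (ℚ.*-cancelˡ-≤-pos y {{ℚ.positive (^-pos (^-pos 0<x (suc k)) (suc d))}} (begin
        y ℚ.* x ^ℚ suc d                          ≡⟨ ℚ.*-comm y (x ^ℚ suc d) ⟩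
        x ^ℚ suc d ℚ.* y                          ≡⟨ cong (x ^ℚ suc d ℚ.*_) (Exp.^-assocʳ x (suc k) (suc d)) ⟩
        x ^ℚ suc d ℚ.* x ^ℚ (suc k ℕ.* suc d)     ≡⟨ Exp.^-homo-* x (suc d) (suc k ℕ.* suc d) ⟨
        x ^ℚ (suc (suc k) ℕ.* suc d)              ≤⟨ ^-monoʳ-≤ 1≤x (ℕ.<⇒≤ [1+k]d<ck) ⟩
        x ^ℚ (c ℕ.* suc k)                        ≡⟨ Exp.^-assocʳ x c (suc k) ⟨
        (x ^ℚ c) ^ℚ suc k                         ≤⟨ ^-monoˡ-≤ (^-nonNeg 0≤x c) (ℚ.≤-trans (ℚ.<⇒≤ x^c<q^d)
                                                      (^-monoˡ-≤ (ℚ.<⇒≤ 0<q) q≤xg (suc d))) (suc k) ⟩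
        ((x ℚ.* g) ^ℚ suc d) ^ℚ suc k             ≡⟨ ^-exchange (x ℚ.* g) (suc d) (suc k) ⟩
        ((x ℚ.* g) ^ℚ suc k) ^ℚ suc d             ≡⟨ cong (_^ℚ suc d) (Exp.^-distrib-* x g (suc k)) ⟩
        (x ^ℚ suc k ℚ.* g ^ℚ suc k) ^ℚ suc d      ≡⟨ Exp.^-distrib-* (x ^ℚ suc k) (g ^ℚ suc k) (suc d) ⟩
        y ℚ.* (g ^ℚ suc k) ^ℚ suc d               ∎))
      where y = (x ^ℚ suc k) ^ℚ suc d

  -- Once n ≤ g^(suc k₁) and m / n^s ≤ g^(suc k₂) for one rational `g`, it follows that m ≤ g^K, and
  -- the K-th root of the hypothesis on `G` is G ≤ a g. In the application `G` is the square of the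
  -- arity.
  redundancy-bound : ∀ {δ ε k₁ k₂ s n m G a q₁ q₂} .{{_ : NonZero n}} .{{_ : NonZero (n ℕ.^ s)}} →
    lower δ (+ 1 ℚ./ suc k₁) → lower ε (+ 1 ℚ./ suc k₂) →
    G ℕ.^ (suc k₁ ℕ.* s ℕ.+ suc k₂) ℕ.≤ a ℕ.^ (suc k₁ ℕ.* s ℕ.+ suc k₂) ℕ.* m →
    pow (ℕ→ℚ n) (1ℚ +ᴿ δ) q₁ → pow (+ m ℚ./ (n ℕ.^ s)) ε q₂ →
    ℕ→ℚ (n ℕ.* G) ℚ.≤ ℕ→ℚ a ℚ.* (q₁ ℚ.+ ℕ→ℚ n ℚ.* q₂)
  redundancy-bound {δ} {ε} {k₁} {k₂} {s} {n} {m} {G} {a} {q₁} {q₂} lδ lε G^K≤ pow₁ pow₂ = begin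
    ℕ→ℚ (n ℕ.* G)                         ≡⟨ ℕ→ℚ-* n G ⟩
    ℕ→ℚ n ℚ.* ℕ→ℚ G                       ≤⟨ ℚ.*-monoˡ-≤-nonNeg (ℕ→ℚ n) {{ℚ.nonNegative (0≤ℕ→ℚ n)}} G≤ag ⟩
    ℕ→ℚ n ℚ.* (ℕ→ℚ a ℚ.* g)               ≡⟨ ℚ.*-assoc (ℕ→ℚ n) (ℕ→ℚ a) g ⟨
    ℕ→ℚ n ℚ.* ℕ→ℚ a ℚ.* g                 ≡⟨ cong (ℚ._* g) (ℚ.*-comm (ℕ→ℚ n) (ℕ→ℚ a)) ⟩
    ℕ→ℚ a ℚ.* ℕ→ℚ n ℚ.* g                 ≡⟨ ℚ.*-assoc (ℕ→ℚ a) (ℕ→ℚ n) g ⟩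
    ℕ→ℚ a ℚ.* (ℕ→ℚ n ℚ.* g)               ≡⟨ cong (ℕ→ℚ a ℚ.*_) ng≡ ⟩
    ℕ→ℚ a ℚ.* (q₁ ℚ.+ ℕ→ℚ n ℚ.* q₂)       ∎
    where
    open ℚ.≤-Reasoning
    K = suc k₁ ℕ.* s ℕ.+ suc k₂
    N = ℕ→ℚ n
    y = + m ℚ./ (n ℕ.^ s)
    1/n = + 1 ℚ./ n
    -- The sum takes the place of the maximum of n^δ and (m / n^s)^ε, which makes `N * g` equal to
    -- the redundancy `q₁ + N * q₂`.
    g = 1/n ℚ.* q₁ ℚ.+ q₂
    1≤N : 1ℚ ℚ.≤ N
    1≤N = ℕ→ℚ-mono-≤ {1} {n} (ℕ.>-nonZero⁻¹ n)
    0<N : 0ℚ ℚ.< N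
    0<N = ℚ.<-≤-trans {0ℚ} {1ℚ} (ℚ.*<* (ℤ.+<+ (ℕ.s≤s ℕ.z≤n))) 1≤N
    ng≡ : N ℚ.* g ≡ q₁ ℚ.+ N ℚ.* q₂
    ng≡ = trans (ℚ.*-distribˡ-+ N (1/n ℚ.* q₁) q₂) (cong (ℚ._+ N ℚ.* q₂)
      (trans (sym (ℚ.*-assoc N 1/n q₁)) (trans (cong (ℚ._* q₁) (/-*-cancel 1 n)) (ℚ.*-identityˡ q₁))))
    0<q₂ : 0ℚ ℚ.< q₂
    0<q₂ = proj₁ pow₂
    n≤q₁ : N ℚ.≤ q₁
    n≤q₁ = proj₁ (pow-1+-exponent {δ = δ} {k = k₁} 1≤N lδ pow₁)
    q₁≤ng : q₁ ℚ.≤ N ℚ.* g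
    q₁≤ng = ℚ.≤-trans (ℚ.≤-reflexive (sym (ℚ.+-identityʳ q₁))) (ℚ.≤-trans
      (ℚ.+-monoʳ-≤ q₁ (*-nonNeg (ℚ.<⇒≤ 0<N) (ℚ.<⇒≤ 0<q₂))) (ℚ.≤-reflexive (sym ng≡)))
    1≤g : 1ℚ ℚ.≤ g
    1≤g = ℚ.*-cancelˡ-≤-pos N {{ℚ.positive 0<N}} (ℚ.≤-trans (ℚ.≤-reflexive (ℚ.*-identityʳ N)) (ℚ.≤-trans n≤q₁ q₁≤ng))
    0≤g : 0ℚ ℚ.≤ g
    0≤g = ℚ.≤-trans (0≤ℕ→ℚ 1) 1≤g
    q₂≤g : q₂ ℚ.≤ g
    q₂≤g = ℚ.*-cancelˡ-≤-pos N {{ℚ.positive 0<N}} (ℚ.≤-trans (ℚ.≤-reflexive (sym (ℚ.+-identityˡ (N ℚ.* q₂))))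
      (ℚ.≤-trans (ℚ.+-monoˡ-≤ (N ℚ.* q₂) (ℚ.≤-trans (ℚ.<⇒≤ 0<N) n≤q₁)) (ℚ.≤-reflexive (sym ng≡))))
    n≤g^k₁ : N ℚ.≤ g ^ℚ suc k₁
    n≤g^k₁ = proj₂ (pow-1+-exponent {δ = δ} {k = k₁} 1≤N lδ pow₁) 0≤g q₁≤ng
    y≤g^k₂ : y ℚ.≤ g ^ℚ suc k₂
    y≤g^k₂ with ℚ.≤-total y 1ℚ
    -- For a base below 1 the larger exponent `ε` gives the smaller power, so `q₂` says too little
    -- about y^(1 / suc k₂). There 1 ≤ g suffices, which comes from n ≤ q₁.
    ... | inj₁ y≤1 = ℚ.≤-trans y≤1 (1≤^ 1≤g (suc k₂))
    ... | inj₂ 1≤y = ℚ.≤-trans (pow-exponent {e = ε} {k = k₂} 1≤y lε pow₂) (^-monoˡ-≤ (ℚ.<⇒≤ 0<q₂) q₂≤g (suc k₂))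
    m≤g^K : ℕ→ℚ m ℚ.≤ g ^ℚ K
    m≤g^K = begin
      ℕ→ℚ m                                 ≡⟨ /-*-cancel m (n ℕ.^ s) ⟨
      ℕ→ℚ (n ℕ.^ s) ℚ.* y                   ≤⟨ ℚ.*-monoˡ-≤-nonNeg (ℕ→ℚ (n ℕ.^ s)) {{ℚ.nonNegative (0≤ℕ→ℚ (n ℕ.^ s))}} y≤g^k₂ ⟩
      ℕ→ℚ (n ℕ.^ s) ℚ.* g ^ℚ suc k₂         ≡⟨ cong (ℚ._* g ^ℚ suc k₂) (ℕ→ℚ-^ n s) ⟩
      N ^ℚ s ℚ.* g ^ℚ suc k₂                ≤⟨ ℚ.*-monoʳ-≤-nonNeg (g ^ℚ suc k₂) {{ℚ.nonNegative (^-nonNeg 0≤g (suc k₂))}}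
                                                 (^-monoˡ-≤ (ℚ.<⇒≤ 0<N) n≤g^k₁ s) ⟩
      (g ^ℚ suc k₁) ^ℚ s ℚ.* g ^ℚ suc k₂    ≡⟨ cong (ℚ._* g ^ℚ suc k₂) (Exp.^-assocʳ g (suc k₁) s) ⟩
      g ^ℚ (suc k₁ ℕ.* s) ℚ.* g ^ℚ suc k₂   ≡⟨ Exp.^-homo-* g (suc k₁ ℕ.* s) (suc k₂) ⟨
      g ^ℚ K                                ∎
    G≤ag : ℕ→ℚ G ℚ.≤ ℕ→ℚ a ℚ.* g
    G≤ag = ^-cancelˡ-≤ (*-nonNeg (0≤ℕ→ℚ a) 0≤g) (suc k₁ ℕ.* s ℕ.+ k₂)
      (subst (λ j → ℕ→ℚ G ^ℚ j ℚ.≤ (ℕ→ℚ a ℚ.* g) ^ℚ j) (ℕ.+-suc (suc k₁ ℕ.* s) k₂) (begin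
        ℕ→ℚ G ^ℚ K                   ≡⟨ ℕ→ℚ-^ G K ⟨
        ℕ→ℚ (G ℕ.^ K)                ≤⟨ ℕ→ℚ-mono-≤ G^K≤ ⟩
        ℕ→ℚ (a ℕ.^ K ℕ.* m)          ≡⟨ ℕ→ℚ-* (a ℕ.^ K) m ⟩
        ℕ→ℚ (a ℕ.^ K) ℚ.* ℕ→ℚ m      ≤⟨ ℚ.*-monoˡ-≤-nonNeg (ℕ→ℚ (a ℕ.^ K)) {{ℚ.nonNegative (0≤ℕ→ℚ (a ℕ.^ K))}} m≤g^K ⟩
        ℕ→ℚ (a ℕ.^ K) ℚ.* g ^ℚ K     ≡⟨ cong (ℚ._* g ^ℚ K) (ℕ→ℚ-^ a K) ⟩
        ℕ→ℚ a ^ℚ K ℚ.* g ^ℚ K        ≡⟨ Exp.^-distrib-* (ℕ→ℚ a) g K ⟨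
        (ℕ→ℚ a ℚ.* g) ^ℚ K           ∎))

  -- Reciprocals of reals, and the time and space expressions

  0<1 : 0ℚ ℚ.< 1ℚ
  0<1 = ℚ.*<* (ℤ.+<+ (ℕ.s≤s ℕ.z≤n))

  factor-pos : ∀ {p q} → 0ℚ ℚ.< p → 1ℚ ℚ.≤ p ℚ.* q → 0ℚ ℚ.< q
  factor-pos {p} {q} 0<p 1≤pq = ℚ.*-cancelˡ-<-nonNeg p {{ℚ.nonNegative (ℚ.<⇒≤ 0<p)}}
    (ℚ.≤-<-trans (ℚ.≤-reflexive (ℚ.*-zeroʳ p)) (ℚ.<-≤-trans 0<1 1≤pq))

  recip-bound : ∀ {x : ℝ} {a k} .{{_ : NonZero k}} → (∀ {p} → lower x p → p ℚ.≤ + a ℚ./ k) →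
    ∀ {q} → recip x q → ℕ→ℚ k ℚ.≤ ℕ→ℚ a ℚ.* q
  recip-bound {x} {a} {k} p≤a/k {q} (p , 0<p , p<x , 1≤pq) = begin
    ℕ→ℚ k                          ≡⟨ ℚ.*-identityʳ (ℕ→ℚ k) ⟨
    ℕ→ℚ k ℚ.* 1ℚ                   ≤⟨ ℚ.*-monoˡ-≤-nonNeg (ℕ→ℚ k) {{ℚ.nonNegative (0≤ℕ→ℚ k)}} 1≤pq ⟩
    ℕ→ℚ k ℚ.* (p ℚ.* q)            ≤⟨ ℚ.*-monoˡ-≤-nonNeg (ℕ→ℚ k) {{ℚ.nonNegative (0≤ℕ→ℚ k)}}
                                        (ℚ.*-monoʳ-≤-nonNeg q {{ℚ.nonNegative (ℚ.<⇒≤ (factor-pos 0<p 1≤pq))}} (p≤a/k p<x)) ⟩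
    ℕ→ℚ k ℚ.* (+ a ℚ./ k ℚ.* q)    ≡⟨ ℚ.*-assoc (ℕ→ℚ k) (+ a ℚ./ k) q ⟨
    ℕ→ℚ k ℚ.* (+ a ℚ./ k) ℚ.* q    ≡⟨ cong (ℚ._* q) (/-*-cancel a k) ⟩
    ℕ→ℚ a ℚ.* q                    ∎
    where open ℚ.≤-Reasoning

  -- Locatedness decides between 1 / (j + 2) < x and x < 1 / (j + 1). The first answer lowers `k`;
  -- the second stops at `suc k` equal to j + 3 with 1 / x above j + 1. The factor 3 is the ratio of
  -- these two numbers at j = 0, where it is largest.
  reciprocal-bracket : ∀ {x : ℝ} → 0ℚ <ᴿ x → x ≤ᴿ 1ℚ →
    ∃[ k ] (lower x (+ 1 ℚ./ suc k) × (∀ {q} → recip x q → ℕ→ℚ (suc k) ℚ.≤ ℕ→ℚ 3 ℚ.* q))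
  reciprocal-bracket {x} 0<x x≤1 = let k , l = start-point in search k l
    where
    Result = ∃[ k ] (lower x (+ 1 ℚ./ suc k) × (∀ {q} → recip x q → ℕ→ℚ (suc k) ℚ.≤ ℕ→ℚ 3 ℚ.* q))

    p≤1 : ∀ {p} → lower x p → p ℚ.≤ 1ℚ
    p≤1 p<x = ℚ.≮⇒≥ λ 1<p → x≤1 (lower-closed x 1<p p<x)

    start-point : ∃[ k ] lower x (+ 1 ℚ./ suc k)
    start-point with lower-open x 0<x
    -- A positive rational with denominator `suc d` is at least `1 / suc d`; the further successor
    -- makes the inequality strict, as `lower-closed` demands.
    ... | p@(mkℚ (+ suc a) d _) , 0<p , p<x = suc d , lower-closed x (subst (+ 1 ℚ./ suc (suc d) ℚ.<_) (ℚ.↥p/↧p≡p p)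
            (/-mono-< {1} {suc d} {suc a} {d} (ℕ.<-≤-trans (ℕ.≤-reflexive (cong suc (ℕ.*-identityˡ (suc d)))) (ℕ.m≤m+n (suc (suc d)) _)))) p<x
    ... | mkℚ (+ 0) d _ , ℚ.*<* (ℤ.+<+ ()) , _
    ... | mkℚ ℤ.-[1+ a ] d _ , ℚ.*<* () , _

    search : ∀ k → lower x (+ 1 ℚ./ suc k) → Result
    -- For `k` at most 1, the hypothesis x ≤ 1 bounds `suc k` by 2 / x.
    search 0 l = 0 , l , recip-bound {x} {3} {1} (λ p<x → ℚ.≤-trans (p≤1 p<x) (ℕ→ℚ-mono-≤ {1} {3} (ℕ.s≤s ℕ.z≤n)))
    search 1 l = 1 , l , recip-bound {x} {3} {2} (λ p<x → ℚ.≤-trans (p≤1 p<x)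
      (ℚ.<⇒≤ (/-mono-< {1} {0} {3} {1} (ℕ.s≤s (ℕ.s≤s (ℕ.s≤s ℕ.z≤n))))))
    search (suc (suc j)) l =
      [ search (suc j)
      , (λ u → suc (suc j) , l , recip-bound {x} {3} {suc (suc (suc j))} (λ p<x →
          ℚ.≤-trans (ℚ.<⇒≤ (lower<upper x p<x u)) (ℚ.≮⇒≥ λ q → ℕ.<⇒≱ (/-cancel-< {3} {suc (suc j)} {1} {j} q)
            (ℕ.≤-trans (ℕ.m≤m+n (1 ℕ.* suc (suc (suc j))) (j ℕ.+ j)) (ℕ.≤-reflexive (identity j))))))
      ]′ (located x (/-mono-< {1} {suc j} {1} {j} (ℕ.+-monoˡ-< 0 (ℕ.n<1+n (suc j)))))
      where
      identity : ∀ j → 1 ℕ.* suc (suc (suc j)) ℕ.+ (j ℕ.+ j) ≡ 3 ℕ.* suc j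
      identity = ℕ-Solver.solve-∀

  time-bound : ∀ {δ ε : ℝ} {s k₁ k₂ t a} →
    (∀ {q} → recip δ q → ℕ→ℚ k₁ ℚ.≤ ℕ→ℚ 3 ℚ.* q) → (∀ {q} → recip ε q → ℕ→ℚ k₂ ℚ.≤ ℕ→ℚ 3 ℚ.* q) →
    t ℕ.≤ a ℕ.* (k₁ ℕ.* s ℕ.+ k₂) → t ≤⁺ ⌜ a ℕ.* 3 ⌝ ⊗ (⌜ s ⌝ ⊗ recip δ ⊕ recip ε)
  time-bound {δ} {ε} {s} {k₁} {k₂} {t} {a} bδ bε t≤ q
    (c , e , c> , (e₁ , e₂ , (s′ , r , s′> , rec₁@(_ , 0<p , _ , 1≤pr) , s′r≤) , rec₂ , e₁+e₂≤) , ce≤q) = begin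
    ℕ→ℚ t                                           ≤⟨ ℕ→ℚ-mono-≤ t≤ ⟩
    ℕ→ℚ (a ℕ.* (k₁ ℕ.* s ℕ.+ k₂))                   ≡⟨ trans (ℕ→ℚ-* a (k₁ ℕ.* s ℕ.+ k₂)) (cong (ℕ→ℚ a ℚ.*_)
                                                        (trans (ℕ→ℚ-+ (k₁ ℕ.* s) k₂) (cong (ℚ._+ ℕ→ℚ k₂) (ℕ→ℚ-* k₁ s)))) ⟩
    ℕ→ℚ a ℚ.* (ℕ→ℚ k₁ ℚ.* ℕ→ℚ s ℚ.+ ℕ→ℚ k₂)         ≤⟨ ℚ.*-monoˡ-≤-nonNeg (ℕ→ℚ a) {{ℚ.nonNegative (0≤ℕ→ℚ a)}} (ℚ.+-mono-≤
                                                        (*-mono-≤ (0≤ℕ→ℚ k₁) (0≤ℕ→ℚ s) (bδ rec₁) (ℚ.<⇒≤ s′>)) (bε rec₂)) ⟩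
    ℕ→ℚ a ℚ.* (ℕ→ℚ 3 ℚ.* r ℚ.* s′ ℚ.+ ℕ→ℚ 3 ℚ.* e₂) ≡⟨ cong (ℕ→ℚ a ℚ.*_) (trans (cong (ℚ._+ ℕ→ℚ 3 ℚ.* e₂)
                                                        (trans (ℚ.*-assoc (ℕ→ℚ 3) r s′) (cong (ℕ→ℚ 3 ℚ.*_) (ℚ.*-comm r s′))))
                                                        (sym (ℚ.*-distribˡ-+ (ℕ→ℚ 3) (s′ ℚ.* r) e₂))) ⟩
    ℕ→ℚ a ℚ.* (ℕ→ℚ 3 ℚ.* (s′ ℚ.* r ℚ.+ e₂))         ≡⟨ ℚ.*-assoc (ℕ→ℚ a) (ℕ→ℚ 3) (s′ ℚ.* r ℚ.+ e₂) ⟨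
    ℕ→ℚ a ℚ.* ℕ→ℚ 3 ℚ.* (s′ ℚ.* r ℚ.+ e₂)           ≡⟨ cong (ℚ._* (s′ ℚ.* r ℚ.+ e₂)) (ℕ→ℚ-* a 3) ⟨
    ℕ→ℚ (a ℕ.* 3) ℚ.* (s′ ℚ.* r ℚ.+ e₂)             ≤⟨ *-mono-≤ (0≤ℕ→ℚ (a ℕ.* 3)) 0≤s′r+e₂ (ℚ.<⇒≤ c>)
                                                        (ℚ.≤-trans (ℚ.+-monoˡ-≤ e₂ s′r≤) e₁+e₂≤) ⟩
    c ℚ.* e                                         ≤⟨ ce≤q ⟩
    q                                               ∎
    where
    open ℚ.≤-Reasoning
    0≤e₂ : 0ℚ ℚ.≤ e₂
    0≤e₂ = let _ , 0<p₂ , _ , 1≤p₂e₂ = rec₂ in ℚ.<⇒≤ (factor-pos 0<p₂ 1≤p₂e₂)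
    0≤s′r+e₂ : 0ℚ ℚ.≤ s′ ℚ.* r ℚ.+ e₂
    0≤s′r+e₂ = ℚ.+-mono-≤ {0ℚ} {_} {0ℚ} (*-nonNeg (ℚ.≤-trans (0≤ℕ→ℚ s) (ℚ.<⇒≤ s′>)) (ℚ.<⇒≤ (factor-pos 0<p 1≤pr))) 0≤e₂

  space-bound : ∀ {b C n} {P₁ P₂ : ℝ⁺} {ℓ} → (∀ {q} → P₁ q → 0ℚ ℚ.≤ q) → (∀ {q} → P₂ q → 0ℚ ℚ.≤ q) →
    (∀ {q₁ q₂} → P₁ q₁ → P₂ q₂ → ℕ→ℚ ℓ ℚ.≤ ℕ→ℚ C ℚ.* (q₁ ℚ.+ ℕ→ℚ n ℚ.* q₂)) →
    ℓ ≤⁺ ⌜ b ⌝ ⊕ ⌜ C ⌝ ⊗ (P₁ ⊕ ⌜ n ⌝ ⊗ P₂)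
  space-bound {b} {C} {n} {ℓ = ℓ} 0≤₁ 0≤₂ bound q
    (b′ , e , b′> , (C′ , f , C′> , (q₁ , g , p₁ , (n′ , q₂ , n′> , p₂ , n′q₂≤g) , q₁+g≤f) , C′f≤e) , b′+e≤q) = begin
    ℕ→ℚ ℓ                             ≤⟨ bound p₁ p₂ ⟩
    ℕ→ℚ C ℚ.* (q₁ ℚ.+ ℕ→ℚ n ℚ.* q₂)   ≤⟨ *-mono-≤ (0≤ℕ→ℚ C) 0≤q₁+nq₂ (ℚ.<⇒≤ C′>)
                                          (ℚ.≤-trans (ℚ.+-monoʳ-≤ q₁ nq₂≤g) q₁+g≤f) ⟩
    C′ ℚ.* f                          ≤⟨ C′f≤e ⟩
    e                                 ≡⟨ ℚ.+-identityˡ e ⟨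
    0ℚ ℚ.+ e                          ≤⟨ ℚ.+-monoˡ-≤ e (ℚ.≤-trans (0≤ℕ→ℚ b) (ℚ.<⇒≤ b′>)) ⟩
    b′ ℚ.+ e                          ≤⟨ b′+e≤q ⟩
    q                                 ∎
    where
    open ℚ.≤-Reasoning
    0≤q₁+nq₂ : 0ℚ ℚ.≤ q₁ ℚ.+ ℕ→ℚ n ℚ.* q₂
    0≤q₁+nq₂ = ℚ.+-mono-≤ {0ℚ} {_} {0ℚ} (0≤₁ p₁) (*-nonNeg (0≤ℕ→ℚ n) (0≤₂ p₂))
    nq₂≤g : ℕ→ℚ n ℚ.* q₂ ℚ.≤ g
    nq₂≤g = ℚ.≤-trans (ℚ.*-monoʳ-≤-nonNeg q₂ {{ℚ.nonNegative (0≤₂ p₂)}} (ℚ.<⇒≤ n′>)) n′q₂≤g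

module Dictionaries where

  open import Data.Bool.Base using (Bool; true; false; if_then_else_)
  open import Data.Bool.Properties using (T-≡) renaming (_≟_ to _≟ᵇ_)
  open import Data.Fin.Base as Fin using (Fin)
  open import Data.List.Base using (List; []; _∷_; _++_; length; concatMap; applyUpTo)
  open import Data.List.Properties using (length-++; length-applyUpTo)
  open import Data.Maybe.Base using (just; fromMaybe)
  open import Data.Nat.Base
  open import Data.Nat.Divisibility using (divides)
  open import Data.Nat.DivMod hiding (_div_; _mod_)
  open import Data.Nat.Induction using (<-wellFounded; Acc; acc)
  open import Data.Nat.Logarithm.Core using (⌈log2⌉)
  open import Data.Nat.Properties
  import Data.Nat.Tactic.RingSolver as ℕ-Solver
  open import Data.Product using (_×_; _,_; ∃-syntax)
  open import Data.Vec.Base as Vec using ([]; _∷_; toList)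
  open import Data.Vec.Properties using (tabulate-cong; tabulate∘lookup)
  open import Function.Bundles using (Equivalence)
  open import Relation.Binary.PropositionalEquality
  open import Relation.Nullary using (Dec; yes; no; contradiction)

  -- Arithmetic of machine words

  bit-value : ∀ r → r < 2 → (if r ≡ᵇ 1 then 1 else 0) ≡ r
  bit-value 0 _ = refl
  bit-value 1 _ = refl
  bit-value (suc (suc r)) (s≤s (s≤s ()))

  toℕ-fromℕ : ∀ w {k} → k < 2 ^ w → toℕ (fromℕ w k) ≡ k
  toℕ-fromℕ zero    {zero} _ = refl
  toℕ-fromℕ zero    {suc k} (s≤s ())
  toℕ-fromℕ (suc w) {k} k< = begin
    (if k % 2 ≡ᵇ 1 then 1 else 0) + 2 * toℕ (fromℕ w (k / 2))  ≡⟨ cong₂ (λ a b → a + 2 * b) (bit-value (k % 2) (m%n<n k 2)) (toℕ-fromℕ w k/2<) ⟩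
    k % 2 + 2 * (k / 2)                                        ≡⟨ cong (k % 2 +_) (*-comm 2 (k / 2)) ⟩
    k % 2 + k / 2 * 2                                          ≡⟨ m≡m%n+[m/n]*n k 2 ⟨
    k                                                          ∎
    where
    open ≡-Reasoning
    k/2< : k / 2 < 2 ^ w
    k/2< = m<n*o⇒m/o<n (subst (k <_) (*-comm 2 (2 ^ w)) k<)

  toℕ<2^w : ∀ {w} (v : Word w) → toℕ v < 2 ^ w
  toℕ<2^w []       = s≤s z≤n
  toℕ<2^w {suc w} (b ∷ v) = ≤-<-trans (+-monoˡ-≤ (2 * toℕ v) (bit≤1 b))
    (≤-trans (≤-reflexive (identity (toℕ v))) (*-monoʳ-≤ 2 (toℕ<2^w v)))
    where
    bit≤1 : ∀ b → (if b then 1 else 0) ≤ 1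
    bit≤1 true  = ≤-refl
    bit≤1 false = z≤n
    identity : ∀ t → suc (1 + 2 * t) ≡ 2 * suc t
    identity = ℕ-Solver.solve-∀

  -- `sub` adds `2 ^ w ∸ toℕ v`, so in the absence of a borrow the number to be reduced overshoots
  -- the difference by exactly `2 ^ w`.
  fromℕ-wrap : ∀ w k → fromℕ w (k + 2 ^ w) ≡ fromℕ w k
  fromℕ-wrap zero    k = refl
  fromℕ-wrap (suc w) k = cong₂ (λ r q → (r ≡ᵇ 1) ∷ q)
    (trans (cong (λ j → (k + j) % 2) (*-comm 2 (2 ^ w))) ([m+kn]%n≡m%n k (2 ^ w) 2))
    (trans (cong (fromℕ w) (trans (cong (λ j → (k + j) / 2) (*-comm 2 (2 ^ w)))
      (trans (+-distrib-/-∣ʳ k (divides (2 ^ w) refl)) (cong (k / 2 +_) (m*n/n≡m (2 ^ w) 2)))))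
      (fromℕ-wrap w (k / 2)))

  toℕ-add : ∀ {w} (u v : Word w) → toℕ u + toℕ v < 2 ^ w → toℕ (⟦ add ⟧ u v) ≡ toℕ u + toℕ v
  toℕ-add {w} u v = toℕ-fromℕ w

  toℕ-sub : ∀ {w} (u v : Word w) → toℕ v ≤ toℕ u → toℕ (⟦ sub ⟧ u v) ≡ toℕ u ∸ toℕ v
  toℕ-sub {w} u v v≤u = trans (cong (λ x → toℕ (fromℕ w x)) rearrange)
    (trans (cong toℕ (fromℕ-wrap w (toℕ u ∸ toℕ v))) (toℕ-fromℕ w (≤-<-trans (m∸n≤m (toℕ u) (toℕ v)) (toℕ<2^w u))))
    where
    open ≡-Reasoning
    rearrange : toℕ u + (2 ^ w ∸ toℕ v) ≡ toℕ u ∸ toℕ v + 2 ^ w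
    rearrange = begin
      toℕ u + (2 ^ w ∸ toℕ v)                        ≡⟨ cong (_+ (2 ^ w ∸ toℕ v)) (m∸n+n≡m v≤u) ⟨
      toℕ u ∸ toℕ v + toℕ v + (2 ^ w ∸ toℕ v)        ≡⟨ +-assoc (toℕ u ∸ toℕ v) (toℕ v) _ ⟩
      toℕ u ∸ toℕ v + (toℕ v + (2 ^ w ∸ toℕ v))      ≡⟨ cong (toℕ u ∸ toℕ v +_) (m+[n∸m]≡n (<⇒≤ (toℕ<2^w v))) ⟩
      toℕ u ∸ toℕ v + 2 ^ w                          ∎

  toℕ-div : ∀ {w} (u v : Word w) {d} .{{_ : NonZero d}} → toℕ v ≡ d → toℕ (⟦ div ⟧ u v) ≡ toℕ u / d
  toℕ-div {w} u v {suc d} eq with toℕ v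
  toℕ-div {w} u v {suc d} refl | suc d = toℕ-fromℕ w (≤-<-trans (m/n≤m (toℕ u) (suc d)) (toℕ<2^w u))

  toℕ-mod : ∀ {w} (u v : Word w) {d} .{{_ : NonZero d}} → toℕ v ≡ d → toℕ (⟦ mod ⟧ u v) ≡ toℕ u % d
  toℕ-mod {w} u v {suc d} eq with toℕ v
  toℕ-mod {w} u v {suc d} refl | suc d = toℕ-fromℕ w (≤-<-trans (m%n≤m (toℕ u) (suc d)) (toℕ<2^w u))

  -- Packing cells into the memory image

  nth-++ʳ : ∀ {A : Set} (xs : List A) {ys} i → nth (xs ++ ys) (length xs + i) ≡ nth ys i
  nth-++ʳ []       i = refl
  nth-++ʳ (x ∷ xs) i = nth-++ʳ xs i

  nth-++ˡ : ∀ {A : Set} (xs ys : List A) i {x} → nth xs i ≡ just x → nth (xs ++ ys) i ≡ just x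
  nth-++ˡ (x ∷ xs) ys zero    eq = eq
  nth-++ˡ (x ∷ xs) ys (suc i) eq = nth-++ˡ xs ys i eq

  nth-applyUpTo : ∀ {A : Set} (F : ℕ → A) {n i} → i < n → nth (applyUpTo F n) i ≡ just (F i)
  nth-applyUpTo F {suc n} {zero}  _         = refl
  nth-applyUpTo F {suc n} {suc i} (s≤s i<n) = nth-applyUpTo (λ j → F (suc j)) i<n

  encode : ∀ w → List ℕ → List Bool
  encode w = concatMap (λ c → toList (fromℕ w c))

  length-toList : ∀ {w} (v : Word w) → length (toList v) ≡ w
  length-toList []      = refl
  length-toList (b ∷ v) = cong suc (length-toList v)

  length-encode : ∀ w cs → length (encode w cs) ≡ length cs * w
  length-encode w []       = refl
  length-encode w (c ∷ cs) = trans (length-++ (toList (fromℕ w c))) (cong₂ _+_ (length-toList (fromℕ w c)) (length-encode w cs))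

  nth-toList : ∀ {w} (v : Word w) (j : Fin w) → nth (toList v) (Fin.toℕ j) ≡ just (Vec.lookup v j)
  nth-toList (b ∷ v) Fin.zero    = refl
  nth-toList (b ∷ v) (Fin.suc j) = nth-toList v j

  image-encode : ∀ w cs a {c} → nth cs a ≡ just c → image w (encode w cs) a ≡ fromℕ w c
  image-encode w (c ∷ cs) zero refl = trans
    (tabulate-cong λ j → cong (fromMaybe false) (nth-++ˡ (toList (fromℕ w c)) (encode w cs) (Fin.toℕ j) (nth-toList (fromℕ w c) j)))
    (tabulate∘lookup (fromℕ w c))
  image-encode w (c ∷ cs) (suc a) eq = trans (tabulate-cong shift) (image-encode w cs a eq)
    where
    first = toList (fromℕ w c)
    shift : ∀ (j : Fin w) → fromMaybe false (nth (first ++ encode w cs) (w + a * w + Fin.toℕ j))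
                          ≡ fromMaybe false (nth (encode w cs) (a * w + Fin.toℕ j))
    shift j = cong (fromMaybe false) (trans (cong (nth (first ++ encode w cs))
      (trans (+-assoc w (a * w) (Fin.toℕ j)) (cong (_+ (a * w + Fin.toℕ j)) (sym (length-toList (fromℕ w c))))))
      (nth-++ʳ first (a * w + Fin.toℕ j)))

  -- Digits in base f and the trie of a monotone function

  /-unique : ∀ {z u} d .{{_ : NonZero d}} → u * d ≤ z → z < suc u * d → z / d ≡ u
  /-unique {z} {u} d lo hi = ≤-antisym (≤-pred (m<n*o⇒m/o<n hi))
    (subst (_≤ z / d) (m*n/n≡m u d) (/-monoˡ-≤ d lo))

  [q*d+c]/d : ∀ q {c} d .{{_ : NonZero d}} → c < d → (q * d + c) / d ≡ q
  [q*d+c]/d q {c} d c<d = /-unique d (m≤m+n (q * d) c) (subst (q * d + c <_) (+-comm (q * d) d) (+-monoʳ-< (q * d) c<d))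

  [q*d+c]%d : ∀ q {c} d .{{_ : NonZero d}} → c < d → (q * d + c) % d ≡ c
  [q*d+c]%d q {c} d c<d = trans (cong (_% d) (+-comm (q * d) c)) (trans ([m+kn]%n≡m%n c q d) (m<n⇒m%n≡m c<d))

  index-< : ∀ {i a d c} → i < a → c < d → i * d + c < a * d
  index-< {i} {a} {d} i<a c<d = <-≤-trans (+-monoʳ-< (i * d) c<d) (≤-trans (≤-reflexive (+-comm (i * d) d)) (*-monoˡ-≤ d i<a))

  quot rem : (f k : ℕ) .{{_ : NonZero f}} → ℕ → ℕ
  quot f k y = (y / f ^ k) {{m^n≢0 f k}}
  rem  f k y = (y % f ^ k) {{m^n≢0 f k}}

  quot-unique : ∀ f k .{{_ : NonZero f}} {z u} → u * f ^ k ≤ z → z < suc u * f ^ k → quot f k z ≡ u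
  quot-unique f k = /-unique (f ^ k) {{m^n≢0 f k}}

  quot-< : ∀ f k .{{_ : NonZero f}} {y} → y < f ^ suc k → quot f k y < f
  quot-< f k = m<n*o⇒m/o<n {{m^n≢0 f k}}

  rem-< : ∀ f k .{{_ : NonZero f}} y → rem f k y < f ^ k
  rem-< f k y = m%n<n y (f ^ k) {{m^n≢0 f k}}

  quot-rem : ∀ f k .{{_ : NonZero f}} y → y ≡ quot f k y * f ^ k + rem f k y
  quot-rem f k y = trans (m≡m%n+[m/n]*n y (f ^ k) {{m^n≢0 f k}}) (+-comm (rem f k y) _)

  -- A search of the memory μ that has the k + 1 digits of y left to read, stands
  -- at the node with address p and ends with the answer e. Cells with contents
  -- below base are answers, the others are addresses of nodes.
  data Search (μ : ℕ → ℕ) (f base bound : ℕ) .{{_ : NonZero f}} : (k y p e : ℕ) → Set where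
    found   : ∀ {k y p e} → let a = p + quot f k y in
              μ a ≡ e → e < base → a < bound → Search μ f base bound k y p e
    descend : ∀ {k y p p′ e} → let a = p + quot f (suc k) y in
              μ a ≡ p′ → base ≤ p′ → a < bound →
              Search μ f base bound k (rem f (suc k) y) p′ e →
              Search μ f base bound (suc k) y p e

  module Trie (g : ℕ → ℕ) (g-mono : ∀ {x y} → x ≤ y → g x ≤ g y)
              (n : ℕ) .{{_ : NonZero n}} (g≤n : ∀ x → g x ≤ n)
              (f : ℕ) .{{f≢0 : NonZero f}} (top max base : ℕ) (n<base : n < base) (max< : max < f ^ suc top) where

    ℓ : ℕ
    ℓ = suc top

    -- The upper inverse of `g` on 0 ... b, with default 0 when no argument has a value up to `r`.
    -- The hypothesis `g 0 ≤ r` of `lastBelow-below` excludes the default.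
    lastBelow : ℕ → ℕ → ℕ
    lastBelow zero    r = 0
    lastBelow (suc b) r with g (suc b) ≤? r
    ... | yes _ = suc b
    ... | no  _ = lastBelow b r

    lastBelow-≤ : ∀ b r → lastBelow b r ≤ b
    lastBelow-≤ zero    r = z≤n
    lastBelow-≤ (suc b) r with g (suc b) ≤? r
    ... | yes _ = ≤-refl
    ... | no  _ = m≤n⇒m≤1+n (lastBelow-≤ b r)

    lastBelow-greatest : ∀ b {r x} → x ≤ b → g x ≤ r → x ≤ lastBelow b r
    lastBelow-greatest zero    x≤b gx≤r = x≤b
    lastBelow-greatest (suc b) {r} {x} x≤b gx≤r with g (suc b) ≤? r
    ... | yes _ = x≤b
    ... | no gb≰r = lastBelow-greatest b (≤-pred (≤∧≢⇒< x≤b λ { refl → gb≰r gx≤r })) gx≤r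

    lastBelow-below : ∀ b {r} → g 0 ≤ r → g (lastBelow b r) ≤ r
    lastBelow-below zero    g0≤r = g0≤r
    lastBelow-below (suc b) {r} g0≤r with g (suc b) ≤? r
    ... | yes gb≤r = gb≤r
    ... | no  _    = lastBelow-below b g0≤r

    -- Level i of the trie splits the keys into blocks of length f ^ (ℓ ∸ i). Blocks
    -- on which g is constant need no node. The others, within one level, take
    -- distinct values r < n at their first keys, so the node of such a block is put
    -- at base + (i * n + r) * f, and the block is recovered as that of lastBelow r.
    child : ℕ → ℕ → ℕ → ℕ
    child i zero    v = g v
    child i (suc k) v with g (v * f ^ suc k) ≟ g (suc v * f ^ suc k)
    ... | yes _ = g (v * f ^ suc k)
    ... | no  _ = base + (suc i * n + g (v * f ^ suc k)) * f

    child-const : ∀ i k v → g (v * f ^ suc k) ≡ g (suc v * f ^ suc k) → child i (suc k) v ≡ g (v * f ^ suc k)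
    child-const i k v flat with g (v * f ^ suc k) ≟ g (suc v * f ^ suc k)
    ... | yes _ = refl
    ... | no ≢  = contradiction flat ≢

    child-split : ∀ i k v → g (v * f ^ suc k) ≢ g (suc v * f ^ suc k) →
      child i (suc k) v ≡ base + (suc i * n + g (v * f ^ suc k)) * f
    child-split i k v ≢ with g (v * f ^ suc k) ≟ g (suc v * f ^ suc k)
    ... | yes flat = contradiction flat ≢
    ... | no _      = refl

    entry : ℕ → ℕ → ℕ → ℕ
    entry i r c = child i k (quot f (suc k) (lastBelow max r) * f + c)
      where k = top ∸ i

    -- Every address decodes to a level, a value and a digit, even where no node was placed. Such
    -- entries are junk, but `table-<` bounds them as well, so every cell fits in a word.
    table : ℕ → ℕ
    table a = entry (a / f / n) (a / f % n) (a % f)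

    private
      -- Before an increase `g` is below its bound `n`; hence `n` slots per level are enough.
      g<n : ∀ v k → g (v * f ^ k) ≢ g (suc v * f ^ k) → g (v * f ^ k) < n
      g<n v k ≢ = <-≤-trans (≤∧≢⇒< (g-mono (*-monoˡ-≤ (f ^ k) (n≤1+n v))) ≢) (g≤n _)

      n<end : n < base + ℓ * n * f
      n<end = <-≤-trans n<base (m≤m+n base _)

    child-< : ∀ i k v → k ≡ top ∸ i → child i k v < base + ℓ * n * f
    child-< i zero    v eq = ≤-<-trans (g≤n v) n<end
    child-< i (suc k) v eq with g (v * f ^ suc k) ≟ g (suc v * f ^ suc k)
    ... | yes _ = ≤-<-trans (g≤n _) n<end
    ... | no ≢ = +-monoʳ-< base (*-monoˡ-< f (index-< (s≤s i<top) (g<n v (suc k) ≢)))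
      where
      i<top : i < top
      -- More than one digit is left at level `i`, so the level `suc i` of the child still lies
      -- inside the table.
      i<top = m∸n≢0⇒n<m λ eq0 → 1+n≢0 (trans eq eq0)

    table-< : ∀ a → table a < base + ℓ * n * f
    table-< a = child-< (a / f / n) _ _ refl

    -- The invariant of a search for `x`. A node is known by its level and `r` alone; `lo` and `hi`
    -- ensure that decoding `r` by `lastBelow` returns the block that contains `x`.
    record Node (x k y r : ℕ) : Set where
      field
        block : ℕ
        split : x ≡ block * f ^ suc k + y
        y<    : y < f ^ suc k
        r<n   : r < n
        lo    : block * f ^ suc k ≤ lastBelow max r
        hi    : lastBelow max r < suc block * f ^ suc k

    -- The only block of level 0 contains all keys, so `lastBelow` lands in it for every `r`; the
    -- choice 0 places the root at `base` itself.
    root : ∀ {x} → x ≤ max → Node x top x 0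
    root {x} x≤max = record
      { block = 0 ; split = refl ; y< = ≤-<-trans x≤max max< ; r<n = >-nonZero⁻¹ n ; lo = z≤n
      ; hi = <-≤-trans (≤-<-trans (lastBelow-≤ max 0) max<) (≤-reflexive (sym (+-identityʳ _))) }

    module _ {x i k y r} (i+k≡top : i + k ≡ top) (nd : Node x k y r) where
      open Node nd
      private
        c = quot f k y
        v = block * f + c

      c<f : c < f
      c<f = quot-< f k y<

      table-entry : table ((i * n + r) * f + c) ≡ child i k v
      table-entry = trans
        (cong₂ (λ j c′ → entry (j / n) (j % n) c′) ([q*d+c]/d (i * n + r) f c<f) ([q*d+c]%d (i * n + r) f c<f))
        (trans (cong₂ (λ i′ r′ → entry i′ r′ c) ([q*d+c]/d i n r<n) ([q*d+c]%d i n r<n))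
        (trans (cong (λ k′ → child i k′ (quot f (suc k′) (lastBelow max r) * f + c)) k≡)
        (cong (λ u → child i k (u * f + c)) (quot-unique f (suc k) {u = block} lo hi))))
        where
        k≡ : top ∸ i ≡ k
        k≡ = trans (cong (_∸ i) (sym i+k≡top)) (m+n∸m≡n i k)

      split′ : x ≡ v * f ^ k + rem f k y
      split′ = begin
        x                                             ≡⟨ split ⟩
        block * f ^ suc k + y                         ≡⟨ cong (block * f ^ suc k +_) (quot-rem f k y) ⟩
        block * (f * f ^ k) + (c * f ^ k + rem f k y) ≡⟨ identity block f (f ^ k) c (rem f k y) ⟩
        v * f ^ k + rem f k y                         ∎
        where
        open ≡-Reasoning
        identity : ∀ u f F c z → u * (f * F) + (c * F + z) ≡ (u * f + c) * F + z
        identity = ℕ-Solver.solve-∀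

      block-≤ : v * f ^ k ≤ x
      block-≤ = ≤-trans (m≤m+n _ _) (≤-reflexive (sym split′))

      <-next-block : x < suc v * f ^ k
      <-next-block = ≤-trans (≤-reflexive (cong suc split′)) (≤-trans (+-monoʳ-< (v * f ^ k) (rem-< f k y)) (≤-reflexive (+-comm (v * f ^ k) (f ^ k))))

      address-< : (i * n + r) * f + c < ℓ * n * f
      address-< = index-< (index-< (s≤s (m+n≤o⇒m≤o i (≤-reflexive i+k≡top))) r<n) c<f

    child-node : ∀ {x i k y r} (i+k≡top : i + suc k ≡ top) (nd : Node x (suc k) y r) → x ≤ max →
      let v = Node.block nd * f + quot f (suc k) y in
      g (v * f ^ suc k) ≢ g (suc v * f ^ suc k) → Node x k (rem f (suc k) y) (g (v * f ^ suc k))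
    child-node {x} {i} {k} {y} i+k≡top nd x≤max ≢ = record
      { block = v
      ; split = split′ {i = i} i+k≡top nd
      ; y<    = rem-< f (suc k) y
      ; r<n   = g<n v (suc k) ≢
      -- The first key of the block is at most x ≤ max, so it competes in `lastBelow`. If
      -- `lastBelow` reached the next block, monotonicity would make `g` equal at both block starts,
      -- against `≢`.
      ; lo    = lastBelow-greatest max (≤-trans (block-≤ {i = i} i+k≡top nd) x≤max) ≤-refl
      ; hi    = ≰⇒> λ next≤ → ≢ (≤-antisym (g-mono (*-monoˡ-≤ (f ^ suc k) (n≤1+n v)))
                  (≤-trans (g-mono next≤) (lastBelow-below max (g-mono z≤n))))
      }
      where v = Node.block nd * f + quot f (suc k) y

    module _ {μ : ℕ → ℕ} {bound} (μ-table : ∀ {a} → a < ℓ * n * f → μ (base + a) ≡ table a)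
             (≤bound : base + ℓ * n * f ≤ bound) where

      private
        module At {x i k y r} (i+k≡top : i + k ≡ top) (nd : Node x k y r) where
          c = quot f k y
          v = Node.block nd * f + c

          reassoc : base + (i * n + r) * f + c ≡ base + ((i * n + r) * f + c)
          reassoc = +-assoc base ((i * n + r) * f) c

          value : μ (base + (i * n + r) * f + c) ≡ child i k v
          value = trans (cong μ reassoc) (trans (μ-table (address-< {i = i} i+k≡top nd)) (table-entry {i = i} i+k≡top nd))

          in-bounds : base + (i * n + r) * f + c < bound
          in-bounds = <-≤-trans (≤-trans (≤-reflexive (cong suc reassoc)) (+-monoʳ-< base (address-< {i = i} i+k≡top nd))) ≤bound

          leaf : child i k v ≡ g x → Search μ f base bound k y (base + (i * n + r) * f) (g x)
          leaf eq = found (trans value eq) (≤-<-trans (g≤n x) n<base) in-bounds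

      node-search : ∀ {x i y r} k → i + k ≡ top → x ≤ max → Node x k y r →
        Search μ f base bound k y (base + (i * n + r) * f) (g x)
      node-search {x} {i} {y} zero i+k≡top x≤max nd = leaf (cong g (trans (sym (*-identityʳ v))
        (sym (trans (split′ {i = i} i+k≡top nd) (trans (cong (v * 1 +_) (n<1⇒n≡0 (rem-< f 0 y))) (+-identityʳ (v * 1)))))))
        where open At {i = i} i+k≡top nd
      node-search {x} {i} {y} {r} (suc k) i+k≡top x≤max nd = by-cases (g (v * f ^ suc k) ≟ g (suc v * f ^ suc k))
        where
        open At {i = i} i+k≡top nd
        by-cases : Dec (g (v * f ^ suc k) ≡ g (suc v * f ^ suc k)) → Search μ f base bound (suc k) y (base + (i * n + r) * f) (g x)
        by-cases (yes flat) = leaf (trans (child-const i k v flat) (≤-antisym (g-mono (block-≤ {i = i} i+k≡top nd))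
          (≤-trans (g-mono (<⇒≤ (<-next-block {i = i} i+k≡top nd))) (≤-reflexive (sym flat)))))
        by-cases (no ≢) = descend (trans value (child-split i k v ≢)) (m≤m+n base _) in-bounds
          (node-search k (trans (sym (+-suc i k)) i+k≡top) x≤max (child-node {i = i} i+k≡top nd x≤max ≢))

      search : ∀ {x} → x ≤ max → Search μ f base bound top x base (g x)
      search {x} x≤max = subst (λ p → Search μ f base bound top x p (g x)) (+-identityʳ base)
        (node-search top refl x≤max (root x≤max))

  -- Running the search on the word RAM

  <⇒<ᵇ-true : ∀ {a b} → a < b → (a <ᵇ b) ≡ true
  <⇒<ᵇ-true a<b = Equivalence.to T-≡ (<⇒<ᵇ a<b)

  ≤⇒<ᵇ-false : ∀ {a b} → b ≤ a → (a <ᵇ b) ≡ false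
  ≤⇒<ᵇ-false {a} {b} b≤a with a <ᵇ b in eq
  ... | false = refl
  ... | true  = contradiction (<ᵇ⇒< a b (Equivalence.from T-≡ eq)) (≤⇒≯ b≤a)

  -- Register 6 holds the digits left to read, register 2 the weight of the first
  -- of them and register 4 the last cell read, which is an answer iff it is
  -- below the address of the root in register 5.
  descent : ℕ → Instr → Program
  descent header epilogue =
    const 1 0 ∷ load 2 1 ∷ const 1 1 ∷ load 3 1 ∷ const 1 header ∷ load 4 1 ∷ move 5 4 ∷ move 6 0 ∷
    bin div 1 6 2 ∷ bin add 1 4 1 ∷ load 4 1 ∷ bin mod 6 6 2 ∷ bin div 2 2 3 ∷ jump-lt 4 5 15 ∷ jump 8 ∷
    epilogue ∷ []

  module _ {w header : ℕ} {epilogue : Instr} {M : ℕ → Word w} where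

    private
      P = descent header epilogue
      μ = λ a → toℕ (M a)

    -- That the run gets to the epilogue is expressed in continuation form: every
    -- run from there extends to one from l.
    Reaches : ℕ → (Reg → Word w) → ℕ → ℕ → Set
    Reaches l R T e = ∃[ t ] ∃[ R′ ] (t ≤ T × R′ 0 ≡ R 0 × toℕ (R′ 4) ≡ e ×
      (∀ {t′ τ} → P ⊢ state 15 R′ M ⇓⟨ t′ ⟩ τ → P ⊢ state l R M ⇓⟨ t + t′ ⟩ τ))

    round : (Reg → Word w) → (Reg → Word w)
    round R = reg (exec (bin div 2 2 3) (exec (bin mod 6 6 2) (exec (load 4 1)
      (exec (bin add 1 4 1) (exec (bin div 1 6 2) (state 8 R M))))))

    run-round : ∀ {R b t τ} → (toℕ (round R 4) <ᵇ toℕ (round R 5)) ≡ b →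
      P ⊢ state (if b then 15 else 14) (round R) M ⇓⟨ t ⟩ τ → P ⊢ state 8 R M ⇓⟨ 6 + t ⟩ τ
    run-round refl d = step refl (step refl (step refl (step refl (step refl (step refl d)))))

    module _ {f base : ℕ} .{{_ : NonZero f}} where

      address : ∀ {k y p R} → toℕ (R 6) ≡ y → toℕ (R 2) ≡ f ^ k → toℕ (R 4) ≡ p →
        p + quot f k y < 2 ^ w → toℕ (round R 4) ≡ μ (p + quot f k y)
      address {k} {y} {p} {R} r6 r2 r4 a< = cong μ (trans (toℕ-add (R 4) (⟦ div ⟧ (R 6) (R 2)) (subst (_< 2 ^ w) (sym sum) a<)) sum)
        where
        sum : toℕ (R 4) + toℕ (⟦ div ⟧ (R 6) (R 2)) ≡ p + quot f k y
        sum = cong₂ _+_ r4 (trans (toℕ-div (R 6) (R 2) {{m^n≢0 f k}} r2) (cong (quot f k) r6))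

      -- A round takes six instructions and the jump back is the seventh. Register 0 is never
      -- written in the loop, which leaves the argument of the query to the epilogue.
      search-reaches : ∀ {k y p e R} → Search μ f base (2 ^ w) k y p e →
        toℕ (R 6) ≡ y → toℕ (R 2) ≡ f ^ k → toℕ (R 3) ≡ f → toℕ (R 4) ≡ p → toℕ (R 5) ≡ base →
        Reaches 8 R (7 * suc k) e
      search-reaches {k} {y} {p} {e} {R} (found μ≡ e<base a<) r6 r2 r3 r4 r5 =
        6 , round R , ≤-trans (n≤1+n 6) (*-monoʳ-≤ 7 (s≤s z≤n)) , refl , answer≡
        , run-round {R} (<⇒<ᵇ-true (subst₂ _<_ (sym answer≡) (sym r5) e<base))
        where
        answer≡ : toℕ (round R 4) ≡ e
        answer≡ = trans (address {k} {R = R} r6 r2 r4 a<) μ≡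
      search-reaches {suc k} {y} {p} {e} {R} (descend {p′ = p′} μ≡ base≤p′ a< s) r6 r2 r3 r4 r5 =
        let t , R′ , t≤ , r0 , r4′ , continue = search-reaches {R = round R} s
              (trans (toℕ-mod (R 6) (R 2) {{m^n≢0 f (suc k)}} r2) (cong (rem f (suc k)) r6))
              (trans (toℕ-div (R 2) (R 3) r3) (trans (cong (_/ f) (trans r2 (*-comm f (f ^ k)))) (m*n/n≡m (f ^ k) f)))
              r3 pointer≡ r5 in
        7 + t , R′ , ≤-trans (+-monoʳ-≤ 7 t≤) (≤-reflexive (sym (*-suc 7 (suc k)))) , r0 , r4′
        , λ d → run-round {R} (≤⇒<ᵇ-false (subst₂ _≤_ (sym r5) (sym pointer≡) base≤p′)) (step refl (continue d))
        where
        pointer≡ : toℕ (round R 4) ≡ p′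
        pointer≡ = trans (address {suc k} {R = R} r6 r2 r4 a<) μ≡

      -- The initial registers are the same for all stored bits, so `start w [] x` supplies them
      -- while the memory is `M`. The 8 counts the instructions before the loop.
      start-reaches : ∀ {top x e} → let R = reg (start w [] x) in
        x < 2 ^ w → 1 < 2 ^ w → header < 2 ^ w → μ 0 ≡ f ^ top → μ 1 ≡ f → μ header ≡ base →
        Search μ f base (2 ^ w) top x base e → Reaches 0 R (8 + 7 * suc top) e
      start-reaches {top} {x} {e} x< 1< header< μ0 μ1 μh s =
        let t , R′ , t≤ , r0 , r4 , continue = search-reaches {R = R₈} s (toℕ-fromℕ w x<)
              (trans (cong μ (toℕ-fromℕ w (<-trans (s≤s z≤n) 1<))) μ0) (trans (cong μ (toℕ-fromℕ w 1<)) μ1)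
              base≡ base≡ in
        8 + t , R′ , +-monoʳ-≤ 8 t≤ , r0 , r4
        , λ d → step refl (step refl (step refl (step refl (step refl (step refl (step refl (step refl (continue d))))))))
        where
        R₈ = reg (exec (move 6 0) (exec (move 5 4) (exec (load 4 1) (exec (const 1 header) (exec (load 3 1)
               (exec (const 1 1) (exec (load 2 1) (exec (const 1 0) (state 0 (reg (start w [] x)) M)))))))))
        base≡ : μ (toℕ (fromℕ w header)) ≡ base
        base≡ = trans (cong μ (toℕ-fromℕ w header<)) μh

  -- Rank and select as functions of the bitstring

  rank-mono : ∀ S {i j} → i ≤ j → rank true S i ≤ rank true S j
  rank-mono S           z≤n       = z≤n
  rank-mono []          (s≤s i≤j) = z≤n
  rank-mono (false ∷ S) (s≤s i≤j) = rank-mono S i≤j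
  rank-mono (true ∷ S)  (s≤s i≤j) = s≤s (rank-mono S i≤j)

  rank-≤ : ∀ S i → rank true S i ≤ occ true S
  rank-≤ S           zero    = z≤n
  rank-≤ []          (suc i) = z≤n
  rank-≤ (false ∷ S) (suc i) = rank-≤ S i
  rank-≤ (true ∷ S)  (suc i) = s≤s (rank-≤ S i)

  rank-false+true : ∀ S i → i ≤ length S → rank false S i + rank true S i ≡ i
  rank-false+true S           zero    _        = refl
  rank-false+true (false ∷ S) (suc i) (s≤s i≤) = cong suc (rank-false+true S i i≤)
  rank-false+true (true ∷ S)  (suc i) (s≤s i≤) = trans (+-suc (rank false S i) (rank true S i)) (cong suc (rank-false+true S i i≤))

  occ-≤ : ∀ b S → occ b S ≤ length S
  occ-≤ b []      = z≤n
  occ-≤ b (x ∷ S) with b ≟ᵇ x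
  ... | yes _ = s≤s (occ-≤ b S)
  ... | no  _ = m≤n⇒m≤1+n (occ-≤ b S)

  select-≤ : ∀ b S i → select b S i ≤ length S
  select-≤ b S       zero    = z≤n
  select-≤ b []      (suc i) = z≤n
  select-≤ b (x ∷ S) (suc i) with b ≟ᵇ x
  ... | yes _ = s≤s (select-≤ b S i)
  ... | no  _ = s≤s (select-≤ b S (suc i))

  -- The number of ones before the i-th zero, or of all ones if there are fewer
  -- than i zeros.
  onesBefore : List Bool → ℕ → ℕ
  onesBefore S           zero    = 0
  onesBefore []          (suc i) = 0
  onesBefore (false ∷ S) (suc i) = onesBefore S i
  onesBefore (true ∷ S)  (suc i) = suc (onesBefore S (suc i))

  onesBefore-mono : ∀ S {i j} → i ≤ j → onesBefore S i ≤ onesBefore S j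
  onesBefore-mono S           z≤n       = z≤n
  onesBefore-mono []          (s≤s i≤j) = z≤n
  onesBefore-mono (false ∷ S) (s≤s i≤j) = onesBefore-mono S i≤j
  onesBefore-mono (true ∷ S)  (s≤s i≤j) = s≤s (onesBefore-mono S (s≤s i≤j))

  onesBefore-≤ : ∀ S i → onesBefore S i ≤ occ true S
  onesBefore-≤ S           zero    = z≤n
  onesBefore-≤ []          (suc i) = z≤n
  onesBefore-≤ (false ∷ S) (suc i) = onesBefore-≤ S i
  onesBefore-≤ (true ∷ S)  (suc i) = s≤s (onesBefore-≤ S (suc i))

  -- The prefix that ends at the i-th zero consists of `i` zeros and of the ones before it.
  select-false : ∀ S i → i ≤ occ false S → select false S i ≡ i + onesBefore S i
  select-false S           zero    _        = refl
  select-false (false ∷ S) (suc i) (s≤s i≤) = cong suc (select-false S i i≤)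
  select-false (true ∷ S)  (suc i) i≤       =
    cong suc (trans (select-false S (suc i) i≤) (sym (+-suc i (onesBefore S (suc i)))))

  -- Logarithms and the choice of the arity

  n≤⌈n/2⌉+⌈n/2⌉ : ∀ n → n ≤ ⌈ n /2⌉ + ⌈ n /2⌉
  n≤⌈n/2⌉+⌈n/2⌉ n = ≤-trans (≤-reflexive (sym (⌊n/2⌋+⌈n/2⌉≡n n))) (+-monoˡ-≤ ⌈ n /2⌉ (⌊n/2⌋≤⌈n/2⌉ n))

  ⌈n/2⌉+⌈n/2⌉≤1+n : ∀ n → ⌈ n /2⌉ + ⌈ n /2⌉ ≤ suc n
  ⌈n/2⌉+⌈n/2⌉≤1+n n = ≤-trans (+-monoʳ-≤ ⌊ suc n /2⌋ (⌊n/2⌋≤⌈n/2⌉ (suc n))) (≤-reflexive (⌊n/2⌋+⌈n/2⌉≡n (suc n)))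

  -- An arbitrary accessibility proof lets the induction follow the recursion of `⌈log2⌉`, which
  -- passes to the half of its argument rounded up.
  n<2^⌈log2⌉ : ∀ n (rs : Acc _<_ (suc n)) → n < 2 ^ ⌈log2⌉ (suc n) rs
  n<2^⌈log2⌉ zero    _        = s≤s z≤n
  n<2^⌈log2⌉ (suc n) (acc rs) = begin-strict
    suc n                                  ≤⟨ s≤s (n≤⌈n/2⌉+⌈n/2⌉ n) ⟩
    suc (⌈ n /2⌉ + ⌈ n /2⌉)                <⟨ ≤-reflexive (identity ⌈ n /2⌉) ⟩
    2 * suc ⌈ n /2⌉                        ≤⟨ *-monoʳ-≤ 2 (n<2^⌈log2⌉ ⌈ n /2⌉ _) ⟩
    2 ^ ⌈log2⌉ (suc (suc n)) (acc rs)      ∎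
    where
    open ≤-Reasoning
    identity : ∀ j → suc (suc (j + j)) ≡ 2 * suc j
    identity = ℕ-Solver.solve-∀

  -- Twice the argument, `2 * suc (suc n)`, would not be inductive, since rounding the half up loses
  -- one; the bound with `suc n` absorbs that loss.
  2^⌈log2⌉≤2*n : ∀ n (rs : Acc _<_ (suc (suc n))) → 2 ^ ⌈log2⌉ (suc (suc n)) rs ≤ 2 * suc n
  2^⌈log2⌉≤2*n zero    (acc rs) = ≤-refl
  2^⌈log2⌉≤2*n (suc n) (acc rs) = *-monoʳ-≤ 2 (≤-trans (2^⌈log2⌉≤2*n ⌊ n /2⌋ (rs (⌈n/2⌉<n (suc n))))
    (≤-trans (≤-reflexive (cong (⌈ suc n /2⌉ +_) (+-identityʳ ⌈ suc n /2⌉))) (⌈n/2⌉+⌈n/2⌉≤1+n (suc n))))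

  m<2^lg : ∀ m → m < 2 ^ lg m
  m<2^lg m = n<2^⌈log2⌉ m (<-wellFounded (suc m))

  2^lg≤2*m : ∀ m .{{_ : NonZero m}} → 2 ^ lg m ≤ 2 * m
  2^lg≤2*m (suc m) = 2^⌈log2⌉≤2*n m (<-wellFounded (suc (suc m)))

  n<2^n : ∀ n → n < 2 ^ n
  n<2^n zero    = s≤s z≤n
  n<2^n (suc n) = begin-strict
    suc n              <⟨ s≤s (n<2^n n) ⟩
    suc (2 ^ n)        ≤⟨ +-monoˡ-≤ (2 ^ n) (m^n>0 2 n) ⟩
    2 ^ n + 2 ^ n      ≡⟨ cong (2 ^ n +_) (+-identityʳ (2 ^ n)) ⟨
    2 ^ suc n          ∎
    where open ≤-Reasoning

  -- The arity 2 ^ h and depth 1 + top of a trie on the keys 0 … m, where K = 2 K′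
  -- bounds the depth and the arity is about m ^ (1 / K).
  module Shape (m K′ : ℕ) .{{_ : NonZero m}} .{{_ : NonZero K′}} where

    K L h f top : ℕ
    K   = 2 * K′
    private instance
      K≢0 : NonZero K
      K≢0 = m*n≢0 2 K′
    L   = lg m
    h   = suc (L / K)
    f   = 2 ^ h
    top = L / h

    f≢0 : NonZero f
    f≢0 = m^n≢0 2 h

    -- The successor in `h` makes K digits of `h` bits enough for `L` bits. The excess is at most
    -- `K` bits by `hK≤L+K`, a constant factor for `f ^ K`.
    L<hK : L < h * K
    L<hK = ≤-trans (≤-reflexive (cong suc (m≡m%n+[m/n]*n L K))) (+-monoˡ-≤ (L / K * K) (m%n<n L K))

    hK≤L+K : h * K ≤ L + K
    hK≤L+K = ≤-trans (≤-reflexive (+-comm K (L / K * K))) (+-monoˡ-≤ K (m/n*n≤m L K))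

    depth≤K : suc top ≤ K
    depth≤K = m<n*o⇒m/o<n (≤-trans L<hK (≤-reflexive (*-comm h K)))

    L≤Kf : L ≤ K * f
    L≤Kf = ≤-trans (<⇒≤ L<hK) (≤-trans (≤-reflexive (*-comm h K)) (*-monoʳ-≤ K (<⇒≤ (n<2^n h))))

    m<f^depth : m < f ^ suc top
    m<f^depth = begin-strict
      m                   <⟨ m<2^lg m ⟩
      2 ^ L               ≤⟨ ^-monoʳ-≤ 2 L≤h*depth ⟩
      2 ^ (h * suc top)   ≡⟨ ^-*-assoc 2 h (suc top) ⟨
      f ^ suc top         ∎
      where
      open ≤-Reasoning
      L≤h*depth : L ≤ h * suc top
      L≤h*depth = begin
        L                      ≡⟨ m≡m%n+[m/n]*n L h ⟩
        L % h + top * h        ≤⟨ +-monoˡ-≤ (top * h) (<⇒≤ (m%n<n L h)) ⟩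
        suc top * h            ≡⟨ *-comm (suc top) h ⟩
        h * suc top            ∎

    f^top≤2^L : f ^ top ≤ 2 ^ L
    f^top≤2^L = ≤-trans (≤-reflexive (trans (^-*-assoc 2 h top) (cong (2 ^_) (*-comm h top)))) (^-monoʳ-≤ 2 (m/n*n≤m L h))

    f≤2^[1+L] : f ≤ 2 * 2 ^ L
    f≤2^[1+L] = ^-monoʳ-≤ 2 (s≤s (m/n≤m L K))

    depth≤2^L : suc top ≤ 2 ^ L
    depth≤2^L = ≤-trans (s≤s (m/n≤m L h)) (n<2^n L)

    -- In 16, one factor 4 pays for the rounding of `h`, as `2 ^ K` is `4 ^ K′`, and the other one
    -- covers the 2 of `2 ^ L ≤ 2 * m`.
    [f*f]^K′≤ : (f * f) ^ K′ ≤ 16 ^ K′ * m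
    [f*f]^K′≤ = begin
      (f * f) ^ K′                  ≡⟨ cong (_^ K′) (cong (f *_) (sym (*-identityʳ f))) ⟩
      (f ^ 2) ^ K′                  ≡⟨ trans (^-*-assoc f 2 K′) (^-*-assoc 2 h K) ⟩
      2 ^ (h * K)                   ≤⟨ ^-monoʳ-≤ 2 hK≤L+K ⟩
      2 ^ (L + K)                   ≡⟨ ^-distribˡ-+-* 2 L K ⟩
      2 ^ L * 2 ^ K                 ≡⟨ cong (2 ^ L *_) (^-*-assoc 2 2 K′) ⟨
      2 ^ L * 4 ^ K′                ≤⟨ *-monoˡ-≤ (4 ^ K′) (2^lg≤2*m m) ⟩
      2 * m * 4 ^ K′                ≤⟨ *-monoˡ-≤ (4 ^ K′) (*-monoˡ-≤ m 2≤4^K′) ⟩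
      4 ^ K′ * m * 4 ^ K′           ≡⟨ rearrange (4 ^ K′) m ⟩
      4 ^ K′ * 4 ^ K′ * m           ≡⟨ cong (_* m) 4^K′*4^K′ ⟩
      16 ^ K′ * m                   ∎
      where
      open ≤-Reasoning
      2≤4^K′ : 2 ≤ 4 ^ K′
      2≤4^K′ = ≤-trans (s≤s (s≤s z≤n)) (^-monoʳ-≤ 4 {1} (>-nonZero⁻¹ K′))
      4^K′*4^K′ : 4 ^ K′ * 4 ^ K′ ≡ 16 ^ K′
      4^K′*4^K′ = trans (sym (^-distribˡ-+-* 4 K′ K′)) (trans (cong (λ j → 4 ^ (K′ + j)) (sym (+-identityʳ K′))) (sym (^-*-assoc 4 2 K′)))
      rearrange : ∀ a m → a * m * a ≡ a * a * m
      rearrange = ℕ-Solver.solve-∀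

  -- The dictionary and its queries

  queries : Op → Program
  queries (rank-op true)    = descent 2 (move 0 4)
  queries (rank-op false)   = descent 2 (bin sub 0 0 4)
  queries (select-op true)  = const 1 4 ∷ bin add 1 1 0 ∷ load 0 1 ∷ []
  queries (select-op false) = descent 3 (bin add 0 0 4)

  module Dictionary (S : List Bool) (K′ : ℕ) .{{_ : NonZero K′}} .{{_ : NonZero (occ true S)}} .{{_ : NonZero (length S)}} where

    n m : ℕ
    n = occ true S
    m = length S

    open Shape m K′

    private instance
      _ : NonZero f
      _ = f≢0

    size base₁ base₂ : ℕ
    size  = suc top * n * f
    -- Four header cells and the `suc n` cells of `selects`. The value of `select` at 0 is a
    -- placeholder, so that the query only has to add 4 to its argument.
    base₁ = 5 + n
    base₂ = base₁ + size

    module T₁ = Trie (rank true S) (rank-mono S) n (rank-≤ S) f top m base₁ (s≤s (m≤n+m n 4)) m<f^depth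
    module T₂ = Trie (onesBefore S) (onesBefore-mono S) n (onesBefore-≤ S) f top m base₂
      (s≤s (≤-trans (m≤n+m n 4) (m≤m+n (4 + n) size))) m<f^depth

    selects table₁ table₂ cells : List ℕ
    selects = applyUpTo (select true S) (suc n)
    table₁  = applyUpTo T₁.table size
    table₂  = applyUpTo T₂.table size
    -- The header holds the weight of the first digit, the arity and the two roots. All that depends
    -- on the string or on the parameters is thus read from memory, and `queries` is fixed once and
    -- for all.
    cells   = f ^ top ∷ f ∷ base₁ ∷ base₂ ∷ selects ++ table₁ ++ table₂

    length-cells : length cells ≡ base₂ + size
    length-cells = cong (4 +_) (trans (length-++ selects) (trans (cong₂ _+_ (length-applyUpTo (select true S) (suc n))
      (trans (length-++ table₁) (cong₂ _+_ (length-applyUpTo T₁.table size) (length-applyUpTo T₂.table size))))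
      (sym (+-assoc (suc n) size size))))

    nth-selects : ∀ {i} → i ≤ n → nth cells (4 + i) ≡ just (select true S i)
    nth-selects {i} i≤n = nth-++ˡ selects (table₁ ++ table₂) i (nth-applyUpTo (select true S) (s≤s i≤n))

    nth-tables : ∀ a → nth cells (base₁ + a) ≡ nth (table₁ ++ table₂) a
    nth-tables a = trans (cong (λ j → nth (selects ++ table₁ ++ table₂) (j + a)) (sym (length-applyUpTo (select true S) (suc n))))
      (nth-++ʳ selects a)

    nth-table₁ : ∀ {a} → a < size → nth cells (base₁ + a) ≡ just (T₁.table a)
    nth-table₁ {a} a< = trans (nth-tables a) (nth-++ˡ table₁ table₂ a (nth-applyUpTo T₁.table a<))

    nth-table₂ : ∀ {a} → a < size → nth cells (base₂ + a) ≡ just (T₂.table a)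
    nth-table₂ {a} a< = trans (cong (nth cells) (+-assoc base₁ size a)) (trans (nth-tables (size + a))
      (trans (cong (λ j → nth (table₁ ++ table₂) (j + a)) (sym (length-applyUpTo T₁.table size)))
        (trans (nth-++ʳ table₁ a) (nth-applyUpTo T₂.table a<))))

    n≤size : n ≤ size
    n≤size = ≤-trans (m≤n*m n (suc top)) (m≤m*n (suc top * n) f)

    -- The origin of `κ₀`: with Z = 2^L, each table has at most 2 Z³ cells and the whole memory at
    -- most 8 Z³. As m ≥ 1 gives Z ≥ 2, this is at most Z⁶, so addresses of 6 L bits suffice.
    cells≤2^6L : base₂ + size ≤ 2 ^ (6 * L)
    cells≤2^6L = begin
      5 + n + size + size                              ≤⟨ +-mono-≤ (+-mono-≤ (+-mono-≤ (s≤s (s≤s (s≤s (s≤s (s≤s (z≤n {3})))))) n≤Z³) size≤) size≤ ⟩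
      8 + Z³ + 2 * Z³ + 2 * Z³                         ≤⟨ +-monoˡ-≤ (2 * Z³) (+-monoˡ-≤ (2 * Z³) (+-monoˡ-≤ Z³ 8≤Z³)) ⟩
      Z³ + Z³ + 2 * Z³ + 2 * Z³                        ≤⟨ ≤-trans (m≤m+n _ (2 * Z³)) (≤-reflexive (identity Z³)) ⟩
      8 * Z³                                           ≤⟨ *-monoˡ-≤ Z³ 8≤Z³ ⟩
      Z³ * Z³                                          ≡⟨ ^-distribˡ-+-* Z 3 3 ⟨
      Z ^ 6                                            ≡⟨ trans (^-*-assoc 2 L 6) (cong (2 ^_) (*-comm L 6)) ⟩
      2 ^ (6 * L)                                      ∎
      where
      open ≤-Reasoning
      Z = 2 ^ L
      Z³ = Z ^ 3
      2≤Z : 2 ≤ Z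
      2≤Z = ≤-trans (s≤s (>-nonZero⁻¹ m)) (m<2^lg m)
      8≤Z³ : 8 ≤ Z³
      8≤Z³ = ^-monoˡ-≤ 3 2≤Z
      n≤Z : n ≤ Z
      n≤Z = ≤-trans (occ-≤ true S) (<⇒≤ (m<2^lg m))
      n≤Z³ : n ≤ Z³
      n≤Z³ = ≤-trans n≤Z (m≤m*n Z (Z ^ 2) {{m^n≢0 Z 2 {{m^n≢0 2 L}}}})
      size≤ : size ≤ 2 * Z³
      size≤ = ≤-trans (*-mono-≤ (*-mono-≤ depth≤2^L n≤Z) f≤2^[1+L]) (≤-reflexive (rearrange Z))
        where
        rearrange : ∀ Z → Z * Z * (2 * Z) ≡ 2 * (Z * (Z * (Z * 1)))
        rearrange = ℕ-Solver.solve-∀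
      identity : ∀ z → z + z + 2 * z + 2 * z + 2 * z ≡ 8 * z
      identity = ℕ-Solver.solve-∀

    f^top<2^6L : f ^ top < 2 ^ (6 * L)
    f^top<2^6L = ≤-<-trans f^top≤2^L (^-monoʳ-< 2 ≤-refl (m<m+n L (≤-trans 1≤L (m≤m+n L (4 * L)))))
      where
      1≤L : 1 ≤ L
      1≤L = n≢0⇒n>0 λ L≡0 → <⇒≱ (subst (λ j → m < 2 ^ j) L≡0 (m<2^lg m)) (>-nonZero⁻¹ m)

    cells≤ : base₂ + size ≤ 8 * (K * n * f)
    cells≤ = begin
      5 + n + size + size                    ≤⟨ +-mono-≤ (+-mono-≤ (+-mono-≤ (*-monoʳ-≤ 5 1≤x) n≤x) size≤x) size≤x ⟩
      5 * x + x + x + x                      ≡⟨ identity x ⟩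
      8 * x                                  ∎
      where
      open ≤-Reasoning
      x = K * n * f
      size≤x : size ≤ x
      size≤x = *-monoˡ-≤ f (*-monoˡ-≤ n depth≤K)
      n≤x : n ≤ x
      n≤x = ≤-trans n≤size size≤x
      1≤x : 1 ≤ x
      1≤x = ≤-trans (>-nonZero⁻¹ n) n≤x
      identity : ∀ x → 5 * x + x + x + x ≡ 8 * x
      identity = ℕ-Solver.solve-∀

    module _ {w : ℕ} (6L≤w : 6 * L ≤ w) where

      D : List Bool
      D = encode w cells

      private
        μ = λ a → toℕ (image w D a)

        cells≤2^w : base₂ + size ≤ 2 ^ w
        cells≤2^w = ≤-trans cells≤2^6L (^-monoʳ-≤ 2 6L≤w)

        base₂≤2^w : base₂ ≤ 2 ^ w
        base₂≤2^w = ≤-trans (m≤m+n base₂ size) cells≤2^w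

        small : ∀ {k} → k < 5 → k < 2 ^ w
        small k<5 = <-≤-trans k<5 (≤-trans (m≤m+n 5 (n + size)) base₂≤2^w)

        L≤w : L ≤ w
        L≤w = ≤-trans (m≤m+n L (5 * L)) 6L≤w

        ≤m⇒<2^w : ∀ {x} → x ≤ m → x < 2 ^ w
        ≤m⇒<2^w x≤m = ≤-<-trans x≤m (<-≤-trans (m<2^lg m) (^-monoʳ-≤ 2 L≤w))

        nonZero-size : 0 < size
        nonZero-size = ≤-trans (>-nonZero⁻¹ n) n≤size

        μ-cell : ∀ a {c} → nth cells a ≡ just c → c < 2 ^ w → μ a ≡ c
        μ-cell a eq c< = trans (cong toℕ (image-encode w cells a eq)) (toℕ-fromℕ w c<)

        μ0 : μ 0 ≡ f ^ top
        μ0 = μ-cell 0 refl (<-≤-trans f^top<2^6L (^-monoʳ-≤ 2 6L≤w))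

        μ1 : μ 1 ≡ f
        μ1 = μ-cell 1 refl (<-≤-trans (s≤s (≤-trans (m≤n*m f (suc top * n) {{m*n≢0 (suc top) n}}) (m≤n+m size (4 + n)))) base₂≤2^w)

        μ2 : μ 2 ≡ base₁
        μ2 = μ-cell 2 refl (<-≤-trans (m<m+n base₁ nonZero-size) base₂≤2^w)

        μ3 : μ 3 ≡ base₂
        μ3 = μ-cell 3 refl (<-≤-trans (m<m+n base₂ nonZero-size) cells≤2^w)

        search₁ : ∀ {x} → x ≤ m → Search μ f base₁ (2 ^ w) top x base₁ (rank true S x)
        search₁ = T₁.search (λ {a} a< → μ-cell (base₁ + a) (nth-table₁ a<) (<-≤-trans (T₁.table-< a) base₂≤2^w)) base₂≤2^w

        search₂ : ∀ {x} → x ≤ m → Search μ f base₂ (2 ^ w) top x base₂ (onesBefore S x)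
        search₂ = T₂.search (λ {a} a< → μ-cell (base₂ + a) (nth-table₂ a<) (<-≤-trans (T₂.table-< a) cells≤2^w)) cells≤2^w

        -- Eight instructions before the loop, seven per digit and one for the epilogue; for a
        -- single digit they add up to exactly 16.
        time≤ : ∀ {t} → t ≤ 8 + 7 * suc top → t + 1 ≤ 16 * K
        time≤ {t} t≤ = begin
          t + 1                      ≤⟨ +-monoˡ-≤ 1 t≤ ⟩
          8 + 7 * suc top + 1        ≤⟨ ≤-trans (m≤m+n _ (9 * top)) (≤-reflexive (identity top)) ⟩
          16 * suc top               ≤⟨ *-monoʳ-≤ 16 depth≤K ⟩
          16 * K                     ∎
          where
          open ≤-Reasoning
          identity : ∀ t → 8 + 7 * suc t + 1 + 9 * t ≡ 16 * suc t
          identity = ℕ-Solver.solve-∀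

      queries-correct : ∀ op i → Valid op S i → ∃[ t ] ∃[ τ ]
        ( queries op ⊢ start w D i ⇓⟨ t ⟩ τ × toℕ (reg τ 0) ≡ answer op S i
        × (∀ a → mem τ a ≡ image w D a) × t ≤ 16 * K )
      queries-correct (rank-op true) i i≤m =
        let t , R , t≤ , r0 , r4 , continue = start-reaches {header = 2} {epilogue = move 0 4} {M = image w D}
              (≤m⇒<2^w i≤m) (small (s≤s (s≤s z≤n))) (small (s≤s (s≤s (s≤s z≤n)))) μ0 μ1 μ2 (search₁ i≤m) in
        t + 1 , _ , continue (step refl (halt refl)) , r4 , (λ _ → refl) , time≤ t≤
      queries-correct (rank-op false) i i≤m =
        let t , R , t≤ , r0 , r4 , continue = start-reaches {header = 2} {epilogue = bin sub 0 0 4} {M = image w D}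
              (≤m⇒<2^w i≤m) (small (s≤s (s≤s z≤n))) (small (s≤s (s≤s (s≤s z≤n)))) μ0 μ1 μ2 (search₁ i≤m)
            r0′ = trans (cong toℕ r0) (toℕ-fromℕ w (≤m⇒<2^w i≤m))
            split = rank-false+true S i i≤m in
        t + 1 , _ , continue (step refl (halt refl))
        , trans (toℕ-sub (R 0) (R 4) (subst₂ _≤_ (sym r4) (sym r0′) (≤-trans (m≤n+m _ (rank false S i)) (≤-reflexive split))))
            (trans (cong₂ _∸_ (trans r0′ (sym split)) r4) (m+n∸n≡m (rank false S i) (rank true S i)))
        , (λ _ → refl) , time≤ t≤
      queries-correct (select-op true) i (_ , i≤n) =
        3 , _ , step refl (step refl (step refl (halt refl)))
        , trans (cong μ (trans (toℕ-add (fromℕ w 4) (fromℕ w i) (subst (_< 2 ^ w) (sym sum) 4+i<)) sum))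
            (μ-cell (4 + i) (nth-selects i≤n) (≤m⇒<2^w (select-≤ true S i)))
        , (λ _ → refl) , ≤-trans (s≤s (s≤s (s≤s z≤n))) (*-monoʳ-≤ 16 (≤-trans (s≤s z≤n) depth≤K))
        where
        sum : toℕ (fromℕ w 4) + toℕ (fromℕ w i) ≡ 4 + i
        sum = cong₂ _+_ (toℕ-fromℕ w (small ≤-refl)) (toℕ-fromℕ w (≤m⇒<2^w (≤-trans i≤n (occ-≤ true S))))
        4+i< : 4 + i < 2 ^ w
        4+i< = <-≤-trans (s≤s (+-monoʳ-≤ 4 i≤n)) (≤-trans (m≤m+n base₁ size) base₂≤2^w)
      queries-correct (select-op false) i (_ , i≤) =
        let i≤m = ≤-trans i≤ (occ-≤ false S)
            t , R , t≤ , r0 , r4 , continue = start-reaches {header = 3} {epilogue = bin add 0 0 4} {M = image w D}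
              (≤m⇒<2^w i≤m) (small (s≤s (s≤s z≤n))) (small (s≤s (s≤s (s≤s (s≤s z≤n))))) μ0 μ1 μ3 (search₂ i≤m)
            sum = trans (cong₂ _+_ (trans (cong toℕ r0) (toℕ-fromℕ w (≤m⇒<2^w i≤m))) r4) (sym (select-false S i i≤)) in
        t + 1 , _ , continue (step refl (halt refl))
        , trans (toℕ-add (R 0) (R 4) (subst (_< 2 ^ w) (sym sum) (≤m⇒<2^w (select-≤ false S i)))) sum
        , (λ _ → refl) , time≤ t≤

      -- One factor `f` counts the children of a node, the other bounds the width of a cell through
      -- `L≤Kf`.
      length-D≤ : ∀ {κ} → w ≤ κ * L → length D ≤ 8 * κ * (K * K) * (n * (f * f))
      length-D≤ {κ} w≤κL = begin
        length D                                 ≡⟨ trans (length-encode w cells) (cong (_* w) length-cells) ⟩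
        (base₂ + size) * w                       ≤⟨ *-mono-≤ cells≤ (≤-trans w≤κL (*-monoʳ-≤ κ L≤Kf)) ⟩
        8 * (K * n * f) * (κ * (K * f))          ≡⟨ identity K n f κ ⟩
        8 * κ * (K * K) * (n * (f * f))          ∎
        where
        open ≤-Reasoning
        identity : ∀ K n f κ → 8 * (K * n * f) * (κ * (K * f)) ≡ 8 * κ * (K * K) * (n * (f * f))
        identity = ℕ-Solver.solve-∀

open Reals
open Dictionaries
open import Data.Bool.Base using (Bool; true)
open import Data.Integer.Base using (+_)
open import Data.List.Base using (List; length)
open import Data.Nat.Base using (ℕ; suc; _+_; _*_; _^_; _≤_; _<_; NonZero; >-nonZero; >-nonZero⁻¹)
import Data.Nat.Properties as ℕ
open import Data.Nat.Properties using (m^n≢0)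
open import Data.Product using (Σ-syntax; ∃-syntax; _×_; _,_; proj₁)
open import Data.Rational.Base as ℚ using (0ℚ; 1ℚ; _/_)
import Data.Rational.Properties as ℚ
open import Relation.Binary.PropositionalEquality using (_≡_; refl; sym; cong)

-- Combining the dictionary with the real parameters

module Bounds {δ ε : ℝ} {s k₁ k₂ : ℕ}
  (1/k₁<δ : lower δ (+ 1 / suc k₁)) (δ-bound : ∀ {q} → recip δ q → ℕ→ℚ (suc k₁) ℚ.≤ ℕ→ℚ 3 ℚ.* q)
  (1/k₂<ε : lower ε (+ 1 / suc k₂)) (ε-bound : ∀ {q} → recip ε q → ℕ→ℚ (suc k₂) ℚ.≤ ℕ→ℚ 3 ℚ.* q) where

  K′ : ℕ
  K′ = suc k₁ * s + suc k₂

  private instance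
    K′≢0 : NonZero K′
    K′≢0 = >-nonZero (ℕ.m≤n⇒m≤o+n (suc k₁ * s) (ℕ.m≤m+n 1 k₂))

  A : ℕ → ℕ
  A κ = 8 * κ * (2 * K′ * (2 * K′))

  module _ (κ w : ℕ) (S : List Bool) .{{n≢0 : NonZero (occ true S)}} (6L≤w : 6 * lg (length S) ≤ w) where

    private instance
      m≢0 : NonZero (length S)
      m≢0 = >-nonZero (ℕ.≤-trans (>-nonZero⁻¹ (occ true S)) (occ-≤ true S))

    open Dictionary S K′ using (n; m; D; queries-correct; length-D≤)
    open Shape m K′ using (f; [f*f]^K′≤)

    fid : IsFID w queries S (D 6L≤w) (⌜ 32 * 3 ⌝ ⊗ (⌜ s ⌝ ⊗ recip δ ⊕ recip ε))
    fid op i valid =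
      let t , τ , run , result , mem≡ , t≤ = queries-correct 6L≤w op i valid in
      t , τ , run , result , mem≡ , time-bound {δ} {ε} {s} {suc k₁} {suc k₂} {t} {32} δ-bound ε-bound
        (ℕ.≤-trans t≤ (ℕ.≤-reflexive (sym (ℕ.*-assoc 16 2 K′))))

    space : w ≤ κ * lg m → length (D 6L≤w) ≤⁺ ⌜ B n m ⌝ ⊕ ⌜ A κ * 16 ⌝ ⊗
      (pow (ℕ→ℚ n) (1ℚ +ᴿ δ) ⊕ ⌜ n ⌝ ⊗ pow ((+ m / n ^ s) {{m^n≢0 n s}}) ε)
    space w≤κL = space-bound {B n m} {A κ * 16} {n} {ℓ = length (D 6L≤w)} (λ p → ℚ.<⇒≤ (proj₁ p)) (λ p → ℚ.<⇒≤ (proj₁ p)) bound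
      where
      open ℚ.≤-Reasoning
      bound : ∀ {q₁ q₂} → pow (ℕ→ℚ n) (1ℚ +ᴿ δ) q₁ → pow ((+ m / n ^ s) {{m^n≢0 n s}}) ε q₂ →
        ℕ→ℚ (length (D 6L≤w)) ℚ.≤ ℕ→ℚ (A κ * 16) ℚ.* (q₁ ℚ.+ ℕ→ℚ n ℚ.* q₂)
      bound {q₁} {q₂} p₁ p₂ = begin
        ℕ→ℚ (length (D 6L≤w))                              ≤⟨ ℕ→ℚ-mono-≤ {length (D 6L≤w)} {A κ * (n * (f * f))} (length-D≤ 6L≤w {κ} w≤κL) ⟩
        ℕ→ℚ (A κ * (n * (f * f)))                          ≡⟨ ℕ→ℚ-* (A κ) (n * (f * f)) ⟩
        ℕ→ℚ (A κ) ℚ.* ℕ→ℚ (n * (f * f))                    ≤⟨ ℚ.*-monoˡ-≤-nonNeg (ℕ→ℚ (A κ)) {{ℚ.nonNegative (0≤ℕ→ℚ (A κ))}}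
                                                                (redundancy-bound {δ} {ε} {k₁} {k₂} {s} {n} {m} {f * f} {16} {{n≢0}} {{m^n≢0 n s}}
                                                                  1/k₁<δ 1/k₂<ε [f*f]^K′≤ p₁ p₂) ⟩
        ℕ→ℚ (A κ) ℚ.* (ℕ→ℚ 16 ℚ.* r)                       ≡⟨ ℚ.*-assoc (ℕ→ℚ (A κ)) (ℕ→ℚ 16) r ⟨
        ℕ→ℚ (A κ) ℚ.* ℕ→ℚ 16 ℚ.* r                         ≡⟨ cong (ℚ._* r) (ℕ→ℚ-* (A κ) 16) ⟨
        ℕ→ℚ (A κ * 16) ℚ.* r                               ∎
        where r = q₁ ℚ.+ ℕ→ℚ n ℚ.* q₂

theorem3p1 : ∃[ κ₀ ] ∀ (κ : ℕ) → ∃[ c ]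
    ∀ (s : ℕ) → 0 < s →
    ∀ (δ ε : ℝ) → 0ℚ <ᴿ δ → δ ≤ᴿ 1ℚ → 0ℚ <ᴿ ε → ε ≤ᴿ 1ℚ →
    Σ[ Q ∈ (Op → Program) ] Σ[ C ∈ ℕ ]
    ∀ (n m w : ℕ) .{{_ : NonZero n}} →
    κ₀ * lg m ≤ w → w ≤ κ * lg m →
    ∀ (S : List Bool) → length S ≡ m → occ true S ≡ n →
    Σ[ D ∈ List Bool ]
    ( IsFID w Q S D (⌜ c ⌝ ⊗ (⌜ s ⌝ ⊗ recip δ ⊕ recip ε))
    × length D ≤⁺ ⌜ B n m ⌝ ⊕ ⌜ C ⌝ ⊗
    ( pow (ℕ→ℚ n) (1ℚ +ᴿ δ)
    ⊕ ⌜ n ⌝ ⊗ pow ((+ m / n ^ s) {{m^n≢0 n s}}) ε ) )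
-- The 32 is 16 instructions for each of at most `2 * K′` levels, and 3 is the loss in
-- `reciprocal-bracket`, so the time constant is absolute. The space constant grows with `κ`, which
-- bounds the width of the cells, and with `K′`.
theorem3p1 = 6 , λ κ → 32 * 3 , λ s 0<s δ ε 0<δ δ≤1 0<ε ε≤1 →
  let k₁ , 1/k₁<δ , δ-bound = reciprocal-bracket {δ} 0<δ δ≤1
      k₂ , 1/k₂<ε , ε-bound = reciprocal-bracket {ε} 0<ε ε≤1
      module Bd = Bounds {δ} {ε} {s} {k₁} {k₂} 1/k₁<δ δ-bound 1/k₂<ε ε-bound
  in queries , Bd.A κ * 16 , λ { n m w 6L≤w w≤κL S refl refl → _ , Bd.fid κ w S 6L≤w , Bd.space κ w S 6L≤w w≤κL }
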